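{- For every $k \in \mathbb{N}$, there exists an effective constant $C_k > 0$ so that for every $n \in \mathbb{N}$ there exist integers $1 \le a_1, \ldots, a_k \le n$ so that $$0 < \left\| \sum_{j=1}^{k} \sqrt{a_j} \right\| \le C_k \cdot n^{ -k/2}.$$
   Context: $\mathbb{N} = \{1,2,\ldots\}$ is the set of natural numbers. For a real number $x$, $\|x\| := \min_{m \in \mathbb{Z}} |x - m|$ denotes the distance from $x$ to the nearest integer. The constant $C_k$ depends only on $k$.
   Formalization: The claim is stated for every n ≥ 2 instead of every n in {1,2,…}: for n = 1 the only choice is a_1 = … = a_k = 1, the sum is the integer k, and its distance to the nearest integer is 0, so the strict inequality fails. -}

module Defs where

open import Data.Empty using (⊥-elim)
open import Data.Integer.Base as ℤ using (ℤ; +_)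
import Data.Integer.Properties as ℤ
import Data.Integer.DivMod as ℤ
open import Data.Nat.Base as ℕ using (ℕ; zero; suc; NonZero)
import Data.Nat.DivMod as ℕ
import Data.Nat.Properties as ℕ
open import Data.Nat.Solver using (module +-*-Solver)
open import Data.Product.Base using (∃-syntax; _,_)
open import Data.Rational.Unnormalised.Base as ℚ
  using (ℚᵘ; mkℚᵘ; 0ℚᵘ; NonNegative; _/_; _≃_; *≡*; *≤*; _-_; ∣_∣; floor; ↥_; ↧_; ↧ₙ_)
import Data.Rational.Unnormalised.Properties as ℚ
import Data.Rational.Unnormalised.Solver as ℚ
open import Data.Sum.Base using (inj₁; inj₂)
open import Data.Vec.Functional using (Vector; foldr)
open import Relation.Binary.PropositionalEquality
  using (_≡_; refl; sym; trans; cong; cong₂; subst; subst₂)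
open import Relation.Nullary using (yes; no)

open ℚ.+-*-Solver using (solve; _:=_; _:+_; _:-_; _:*_; :-_)

p≤q+r⇒p-q≤r : ∀ {p q r} → p ℚ.≤ q ℚ.+ r → p - q ℚ.≤ r
p≤q+r⇒p-q≤r {p} {q} {r} h = begin
  p - q         ≤⟨ ℚ.+-monoˡ-≤ (ℚ.- q) h ⟩
  q ℚ.+ r - q   ≃⟨ solve 2 (λ q r → q :+ r :- q := r) ℚ.≃-refl q r ⟩
  r             ∎
  where open ℚ.≤-Reasoning

p≤∣p∣ : ∀ p → p ℚ.≤ ∣ p ∣
p≤∣p∣ p with ℚ.≤-total 0ℚᵘ p
... | inj₁ 0≤p = ℚ.≤-reflexive (ℚ.≃-sym (ℚ.0≤p⇒∣p∣≃p 0≤p))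
... | inj₂ p≤0 = ℚ.≤-trans p≤0 (ℚ.0≤∣p∣ p)

-[p-q]≃q-p : ∀ p q → ℚ.- (p - q) ≃ q - p
-[p-q]≃q-p = solve 2 (λ p q → :- (p :- q) := q :- p) ℚ.≃-refl

∣p-q∣≃∣q-p∣ : ∀ p q → ∣ p - q ∣ ≃ ∣ q - p ∣
∣p-q∣≃∣q-p∣ p q =
  ℚ.≃-trans (ℚ.≃-sym (ℚ.∣-p∣≃∣p∣ (p - q))) (ℚ.∣-∣-cong (-[p-q]≃q-p p q))

p≤q⇒∣p-q∣≃q-p : ∀ {p q} → p ℚ.≤ q → ∣ p - q ∣ ≃ q - p
p≤q⇒∣p-q∣≃q-p {p} {q} p≤q =
  ℚ.≃-trans (∣p-q∣≃∣q-p∣ p q) (ℚ.0≤p⇒∣p∣≃p (ℚ.p≤q⇒0≤q-p p≤q))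

close : ∀ {p q r} → p ℚ.≤ q ℚ.+ r → q ℚ.≤ p ℚ.+ r → ∣ p - q ∣ ℚ.≤ r
close {p} {q} p≤q+r q≤p+r with ℚ.≤-total p q
... | inj₁ p≤q = ℚ.≤-trans (ℚ.≤-reflexive (p≤q⇒∣p-q∣≃q-p p≤q)) (p≤q+r⇒p-q≤r q≤p+r)
... | inj₂ q≤p = ℚ.≤-trans (ℚ.≤-reflexive (ℚ.0≤p⇒∣p∣≃p (ℚ.p≤q⇒0≤q-p q≤p)))
                           (p≤q+r⇒p-q≤r p≤q+r)

∣p-r∣≤∣p-q∣+∣q-r∣ : ∀ p q r → ∣ p - r ∣ ℚ.≤ ∣ p - q ∣ ℚ.+ ∣ q - r ∣
∣p-r∣≤∣p-q∣+∣q-r∣ p q r = begin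
  ∣ p - r ∣                 ≃⟨ ℚ.∣-∣-cong (ℚ.≃-sym (ℚ.+-minus-telescope p q r)) ⟩
  ∣ (p - q) ℚ.+ (q - r) ∣   ≤⟨ ℚ.∣p+q∣≤∣p∣+∣q∣ (p - q) (q - r) ⟩
  ∣ p - q ∣ ℚ.+ ∣ q - r ∣   ∎
  where open ℚ.≤-Reasoning

------------------------------------------------------------------------
-- Real numbers, as regular Cauchy sequences in the sense of Bishop: the
-- n-th approximation (n ≥ 1) is within 1/n of the number represented.

record ℝ : Set where
  field
    seq : (n : ℕ) .{{_ : NonZero n}} → ℚᵘ
    reg : ∀ m n .{{_ : NonZero m}} .{{_ : NonZero n}} →
          ∣ seq m - seq n ∣ ℚ.≤ + 1 / m ℚ.+ + 1 / n

open ℝ public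

infix 4 _≤ℝ_ _<ℝ_

-- The slack 2/n is the sum of the two approximation errors; hence _≤ℝ_
-- and _<ℝ_ do not depend on the representing sequences.

_≤ℝ_ : ℝ → ℝ → Set
x ≤ℝ y = ∀ n .{{_ : NonZero n}} → seq x n ℚ.≤ seq y n ℚ.+ + 2 / n

_<ℝ_ : ℝ → ℝ → Set
x <ℝ y = ∃[ n ] seq x (suc n) ℚ.+ + 2 / suc n ℚ.< seq y (suc n)

0≤1/n : ∀ n .{{_ : NonZero n}} → 0ℚᵘ ℚ.≤ + 1 / n
0≤1/n (suc n) = ℚ.nonNegative⁻¹ (+ 1 / suc n)

0ℝ : ℝ
0ℝ .seq n = 0ℚᵘ
0ℝ .reg m n = ℚ.+-mono-≤ (0≤1/n m) (0≤1/n n)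

infixl 6 _+ℝ_
infixl 7 _*ℝ_

1/2n+1/2n : ∀ n .{{_ : NonZero n}} .{{_ : NonZero (2 ℕ.* n)}} →
            + 1 / (2 ℕ.* n) ℚ.+ + 1 / (2 ℕ.* n) ≃ + 1 / n
1/2n+1/2n (suc n) = *≡* (cong +_ (eq (suc n)))
  where
  open +-*-Solver renaming (solve to solveℕ; _:=_ to _:≡_; _:+_ to _:⊕_; _:*_ to _:⊛_)
  eq : ∀ n → (1 ℕ.* (2 ℕ.* n) ℕ.+ 1 ℕ.* (2 ℕ.* n)) ℕ.* n ≡ 1 ℕ.* ((2 ℕ.* n) ℕ.* (2 ℕ.* n))
  eq = solveℕ 1 (λ n → (con 1 :⊛ (con 2 :⊛ n) :⊕ con 1 :⊛ (con 2 :⊛ n)) :⊛ n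
                     :≡ con 1 :⊛ ((con 2 :⊛ n) :⊛ (con 2 :⊛ n))) refl

_+ℝ_ : ℝ → ℝ → ℝ
(x +ℝ y) .seq n = seq x (2 ℕ.* n) ℚ.+ seq y (2 ℕ.* n)
  where instance _ = ℕ.m*n≢0 2 n
(x +ℝ y) .reg m n = begin
  ∣ (x₁ ℚ.+ y₁) - (x₂ ℚ.+ y₂) ∣     ≃⟨ ℚ.∣-∣-cong (regroup x₁ y₁ x₂ y₂) ⟩
  ∣ (x₁ - x₂) ℚ.+ (y₁ - y₂) ∣       ≤⟨ ℚ.∣p+q∣≤∣p∣+∣q∣ (x₁ - x₂) (y₁ - y₂) ⟩
  ∣ x₁ - x₂ ∣ ℚ.+ ∣ y₁ - y₂ ∣       ≤⟨ ℚ.+-mono-≤ (reg x (2 ℕ.* m) (2 ℕ.* n)) (reg y (2 ℕ.* m) (2 ℕ.* n)) ⟩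
  (a ℚ.+ b) ℚ.+ (a ℚ.+ b)           ≃⟨ solve 2 (λ a b → (a :+ b) :+ (a :+ b) := (a :+ a) :+ (b :+ b)) ℚ.≃-refl a b ⟩
  (a ℚ.+ a) ℚ.+ (b ℚ.+ b)           ≃⟨ ℚ.+-cong (1/2n+1/2n m) (1/2n+1/2n n) ⟩
  + 1 / m ℚ.+ + 1 / n               ∎
  where
  open ℚ.≤-Reasoning
  instance
    _ = ℕ.m*n≢0 2 m
    _ = ℕ.m*n≢0 2 n
  x₁ = seq x (2 ℕ.* m)
  x₂ = seq x (2 ℕ.* n)
  y₁ = seq y (2 ℕ.* m)
  y₂ = seq y (2 ℕ.* n)
  a = + 1 / (2 ℕ.* m)
  b = + 1 / (2 ℕ.* n)
  regroup : ∀ x y z w → (x ℚ.+ y) - (z ℚ.+ w) ≃ (x - z) ℚ.+ (y - w)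
  regroup = solve 4 (λ x y z w → (x :+ y) :- (z :+ w) := (x :- z) :+ (y :- w)) ℚ.≃-refl

-- A positive integer bound for all approximations of x, as |p/d| ≤ |p|.

bound : ℝ → ℕ
bound x = 2 ℕ.+ ℤ.∣ ↥ seq x 1 ∣

1/n≤1 : ∀ n .{{_ : NonZero n}} → + 1 / n ℚ.≤ + 1 / 1
1/n≤1 (suc n) = *≤* (ℤ.+≤+ (ℕ.s≤s ℕ.z≤n))

∣p∣≤∣↥p∣ : ∀ p → ∣ p ∣ ℚ.≤ + ℤ.∣ ↥ p ∣ / 1
∣p∣≤∣↥p∣ p@(mkℚᵘ n d) = *≤*
  (subst₂ ℤ._≤_ (ℤ.pos-* ℤ.∣ n ∣ 1) (ℤ.pos-* ℤ.∣ n ∣ (suc d))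
    (ℤ.+≤+ (ℕ.*-monoʳ-≤ ℤ.∣ n ∣ (ℕ.s≤s ℕ.z≤n))))

ℕ/1-+ : ∀ m n → + m / 1 ℚ.+ + n / 1 ≃ + (m ℕ.+ n) / 1
ℕ/1-+ m n = *≡* (cong (ℤ._* + 1) (cong₂ ℤ._+_ (ℤ.*-identityʳ (+ m)) (ℤ.*-identityʳ (+ n))))

ℕ/1-mono : ∀ {m n} → m ℕ.≤ n → + m / 1 ℚ.≤ + n / 1
ℕ/1-mono m≤n = *≤* (ℤ.*-monoʳ-≤-nonNeg (+ 1) (ℤ.+≤+ m≤n))

bound-correct : ∀ x n .{{_ : NonZero n}} → ∣ seq x n ∣ ℚ.≤ + bound x / 1
bound-correct x n = begin
  ∣ xₙ ∣                                       ≃⟨ ℚ.∣-∣-cong (split xₙ x₁) ⟩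
  ∣ (xₙ - x₁) ℚ.+ x₁ ∣                         ≤⟨ ℚ.∣p+q∣≤∣p∣+∣q∣ (xₙ - x₁) x₁ ⟩
  ∣ xₙ - x₁ ∣ ℚ.+ ∣ x₁ ∣                       ≤⟨ ℚ.+-mono-≤ (reg x n 1) (∣p∣≤∣↥p∣ x₁) ⟩
  (+ 1 / n ℚ.+ + 1 / 1) ℚ.+ + ℤ.∣ ↥ x₁ ∣ / 1   ≤⟨ ℚ.+-monoˡ-≤ _ (ℚ.+-monoˡ-≤ (+ 1 / 1) (1/n≤1 n)) ⟩
  + 2 / 1 ℚ.+ + ℤ.∣ ↥ x₁ ∣ / 1                 ≃⟨ ℕ/1-+ 2 ℤ.∣ ↥ x₁ ∣ ⟩
  + bound x / 1                                ∎
  where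
  open ℚ.≤-Reasoning
  xₙ = seq x n
  x₁ = seq x 1
  split : ∀ p q → p ≃ (p - q) ℚ.+ q
  split = solve 2 (λ p q → p := (p :- q) :+ q) ℚ.≃-refl

1/[mn] : ∀ m n .{{_ : NonZero m}} .{{_ : NonZero n}} .{{_ : NonZero (m ℕ.* n)}} →
         + 1 / (m ℕ.* n) ≃ + 1 / m ℚ.* (+ 1 / n)
1/[mn] (suc m) (suc n) = ℚ.≃-refl

2K*1/2K : ∀ K .{{_ : NonZero (2 ℕ.* K)}} → (+ K / 1 ℚ.+ + K / 1) ℚ.* (+ 1 / (2 ℕ.* K)) ≃ + 1 / 1
2K*1/2K (suc k) = ℚ.≃-trans (ℚ.*-congʳ {+ 1 / (2 ℕ.* K)} {+ K / 1 ℚ.+ + K / 1} {+ (K ℕ.+ K) / 1} (ℕ/1-+ K K))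
                            (*≡* (cong +_ (eq K)))
  where
  K = suc k
  open +-*-Solver renaming (solve to solveℕ; _:=_ to _:≡_; _:+_ to _:⊕_; _:*_ to _:⊛_)
  eq : ∀ K → ((K ℕ.+ K) ℕ.* 1) ℕ.* 1 ≡ 1 ℕ.* (1 ℕ.* (2 ℕ.* K))
  eq = solveℕ 1 (λ K → ((K :⊕ K) :⊛ con 1) :⊛ con 1 :≡ con 1 :⊛ (con 1 :⊛ (con 2 :⊛ K))) refl

_*ℝ_ : ℝ → ℝ → ℝ
(x *ℝ y) .seq n = seq x N ℚ.* seq y N
  where
  K = bound x ℕ.⊔ bound y
  N = (2 ℕ.* K) ℕ.* n
  instance
    _ : NonZero N
    _ = ℕ.m*n≢0 (2 ℕ.* K) n
(x *ℝ y) .reg m n = begin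
  ∣ x₁ ℚ.* y₁ - x₂ ℚ.* y₂ ∣                            ≃⟨ ℚ.∣-∣-cong (regroup x₁ y₁ x₂ y₂) ⟩
  ∣ x₁ ℚ.* (y₁ - y₂) ℚ.+ y₂ ℚ.* (x₁ - x₂) ∣            ≤⟨ ℚ.∣p+q∣≤∣p∣+∣q∣ (x₁ ℚ.* (y₁ - y₂)) (y₂ ℚ.* (x₁ - x₂)) ⟩
  ∣ x₁ ℚ.* (y₁ - y₂) ∣ ℚ.+ ∣ y₂ ℚ.* (x₁ - x₂) ∣        ≤⟨ ℚ.+-mono-≤ (product-≤ x₁ (y₁ - y₂) x₁≤K (reg y M N))
                                                                   (product-≤ y₂ (x₁ - x₂) y₂≤K (reg x M N)) ⟩
  k ℚ.* r ℚ.+ k ℚ.* r                                  ≃⟨ ℚ.+-cong (ℚ.*-congˡ {k} r≃) (ℚ.*-congˡ {k} r≃) ⟩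
  k ℚ.* (u ℚ.* s) ℚ.+ k ℚ.* (u ℚ.* s)                  ≃⟨ collect k u s ⟩
  ((k ℚ.+ k) ℚ.* u) ℚ.* s                              ≃⟨ ℚ.*-congʳ {s} (2K*1/2K K) ⟩
  (+ 1 / 1) ℚ.* s                                      ≃⟨ ℚ.*-identityˡ s ⟩
  s                                                    ∎
  where
  open ℚ.≤-Reasoning
  K = bound x ℕ.⊔ bound y
  M = (2 ℕ.* K) ℕ.* m
  N = (2 ℕ.* K) ℕ.* n
  instance
    _ : NonZero M
    _ = ℕ.m*n≢0 (2 ℕ.* K) m
    _ : NonZero N
    _ = ℕ.m*n≢0 (2 ℕ.* K) n
  x₁ = seq x M
  x₂ = seq x N
  y₁ = seq y M
  y₂ = seq y N
  k = + K / 1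
  u = + 1 / (2 ℕ.* K)
  r = + 1 / M ℚ.+ + 1 / N
  s = + 1 / m ℚ.+ + 1 / n
  x₁≤K : ∣ x₁ ∣ ℚ.≤ k
  x₁≤K = ℚ.≤-trans (bound-correct x M) (ℕ/1-mono (ℕ.m≤m⊔n (bound x) (bound y)))
  y₂≤K : ∣ y₂ ∣ ℚ.≤ k
  y₂≤K = ℚ.≤-trans (bound-correct y N) (ℕ/1-mono (ℕ.m≤n⊔m (bound x) (bound y)))
  r≃ : r ≃ u ℚ.* s
  r≃ = ℚ.≃-trans (ℚ.+-cong (1/[mn] (2 ℕ.* K) m) (1/[mn] (2 ℕ.* K) n))
                 (ℚ.≃-sym (ℚ.*-distribˡ-+ u (+ 1 / m) (+ 1 / n)))
  product-≤ : ∀ p q {p′ q′} → ∣ p ∣ ℚ.≤ p′ → ∣ q ∣ ℚ.≤ q′ → ∣ p ℚ.* q ∣ ℚ.≤ p′ ℚ.* q′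
  product-≤ p q p≤ q≤ = ℚ.≤-trans (ℚ.≤-reflexive (ℚ.∣p*q∣≃∣p∣*∣q∣ p q))
    (ℚ.*-mono-≤-nonNeg {{ℚ.∣-∣-nonNeg p}} {{ℚ.∣-∣-nonNeg q}} p≤ q≤)
  regroup : ∀ x y z w → x ℚ.* y - z ℚ.* w ≃ x ℚ.* (y - w) ℚ.+ w ℚ.* (x - z)
  regroup = solve 4 (λ x y z w → x :* y :- z :* w := x :* (y :- w) :+ w :* (x :- z)) ℚ.≃-refl
  collect : ∀ k u s → k ℚ.* (u ℚ.* s) ℚ.+ k ℚ.* (u ℚ.* s) ≃ ((k ℚ.+ k) ℚ.* u) ℚ.* s
  collect = solve 3 (λ k u s → k :* (u :* s) :+ k :* (u :* s) := ((k :+ k) :* u) :* s) ℚ.≃-refl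

∑ : ∀ {k} → Vector ℝ k → ℝ
∑ = foldr _+ℝ_ 0ℝ

------------------------------------------------------------------------
-- Square roots

sqrtStep : ℕ → ℕ → ℕ
sqrtStep n s with suc s ℕ.* suc s ℕ.≤? n
... | yes _ = suc s
... | no  _ = s

⌊√_⌋ : ℕ → ℕ
⌊√ zero ⌋ = 0
⌊√ suc n ⌋ = sqrtStep (suc n) ⌊√ n ⌋

⌊√n⌋²≤n : ∀ n → ⌊√ n ⌋ ℕ.* ⌊√ n ⌋ ℕ.≤ n
⌊√n⌋²≤n zero = ℕ.z≤n
⌊√n⌋²≤n (suc n) with suc ⌊√ n ⌋ ℕ.* suc ⌊√ n ⌋ ℕ.≤? suc n
... | yes h = h
... | no  _ = ℕ.m≤n⇒m≤1+n (⌊√n⌋²≤n n)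

n<[1+⌊√n⌋]² : ∀ n → n ℕ.< suc ⌊√ n ⌋ ℕ.* suc ⌊√ n ⌋
n<[1+⌊√n⌋]² zero = ℕ.s≤s ℕ.z≤n
n<[1+⌊√n⌋]² (suc n) with suc ⌊√ n ⌋ ℕ.* suc ⌊√ n ⌋ ℕ.≤? suc n
... | yes _ = ℕ.≤-<-trans (n<[1+⌊√n⌋]² n) (ℕ.*-mono-< (ℕ.n<1+n (suc ⌊√ n ⌋)) (ℕ.n<1+n (suc ⌊√ n ⌋)))
... | no ¬h = ℕ.≰⇒> ¬h

-- ⌊n √(p/d)⌋, computed as ⌊√⌊p n² / d⌋⌋.

approx√ : (p d n : ℕ) .{{_ : NonZero d}} → ℕ
approx√ p d n = ⌊√ p ℕ.* (n ℕ.* n) ℕ./ d ⌋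

approx√-lower : ∀ p d n .{{_ : NonZero d}} → let s = approx√ p d n in
                (s ℕ.* s) ℕ.* d ℕ.≤ p ℕ.* (n ℕ.* n)
approx√-lower p d n = ℕ.≤-trans (ℕ.*-monoˡ-≤ d (⌊√n⌋²≤n (p ℕ.* (n ℕ.* n) ℕ./ d))) (ℕ.m/n*n≤m (p ℕ.* (n ℕ.* n)) d)

approx√-upper : ∀ p d n .{{_ : NonZero d}} → let s = approx√ p d n in
                p ℕ.* (n ℕ.* n) ℕ.< (suc s ℕ.* suc s) ℕ.* d
approx√-upper p d n = begin-strict
  t                              ≡⟨ ℕ.m≡m%n+[m/n]*n t d ⟩
  t ℕ.% d ℕ.+ t ℕ./ d ℕ.* d      <⟨ ℕ.+-monoˡ-< _ (ℕ.m%n<n t d) ⟩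
  suc (t ℕ./ d) ℕ.* d            ≤⟨ ℕ.*-monoˡ-≤ d (n<[1+⌊√n⌋]² (t ℕ./ d)) ⟩
  (suc s ℕ.* suc s) ℕ.* d        ∎
  where
  open ℕ.≤-Reasoning
  t = p ℕ.* (n ℕ.* n)
  s = approx√ p d n

m²<n²⇒m<n : ∀ {m n} → m ℕ.* m ℕ.< n ℕ.* n → m ℕ.< n
m²<n²⇒m<n {m} {n} h with n ℕ.≤? m
... | yes n≤m = ⊥-elim (ℕ.<⇒≱ h (ℕ.*-mono-≤ n≤m n≤m))
... | no  n≰m = ℕ.≰⇒> n≰m

approx√-cross : ∀ p d m n .{{_ : NonZero d}} .{{_ : NonZero m}} .{{_ : NonZero n}} →
                approx√ p d m ℕ.* n ℕ.< suc (approx√ p d n) ℕ.* m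
approx√-cross p d m n = m²<n²⇒m<n (ℕ.*-cancelʳ-< d _ _ (begin-strict
  ((s ℕ.* n) ℕ.* (s ℕ.* n)) ℕ.* d    ≡⟨ e₁ s n d ⟩
  ((s ℕ.* s) ℕ.* d) ℕ.* (n ℕ.* n)    ≤⟨ ℕ.*-monoˡ-≤ (n ℕ.* n) (approx√-lower p d m) ⟩
  (p ℕ.* (m ℕ.* m)) ℕ.* (n ℕ.* n)    ≡⟨ e₂ p m n ⟩
  (p ℕ.* (n ℕ.* n)) ℕ.* (m ℕ.* m)    <⟨ ℕ.*-monoˡ-< (m ℕ.* m) (approx√-upper p d n) ⟩
  ((t ℕ.* t) ℕ.* d) ℕ.* (m ℕ.* m)    ≡⟨ e₁ t m d ⟨
  ((t ℕ.* m) ℕ.* (t ℕ.* m)) ℕ.* d    ∎))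
  where
  open ℕ.≤-Reasoning
  open +-*-Solver renaming (solve to solveℕ; _:=_ to _:≡_; _:*_ to _:⊛_) hiding (_:+_)
  instance _ = ℕ.m*n≢0 m m
  s = approx√ p d m
  t = suc (approx√ p d n)
  e₁ : ∀ s n d → ((s ℕ.* n) ℕ.* (s ℕ.* n)) ℕ.* d ≡ ((s ℕ.* s) ℕ.* d) ℕ.* (n ℕ.* n)
  e₁ = solveℕ 3 (λ s n d → ((s :⊛ n) :⊛ (s :⊛ n)) :⊛ d :≡ ((s :⊛ s) :⊛ d) :⊛ (n :⊛ n)) refl
  e₂ : ∀ p m n → (p ℕ.* (m ℕ.* m)) ℕ.* (n ℕ.* n) ≡ (p ℕ.* (n ℕ.* n)) ℕ.* (m ℕ.* m)
  e₂ = solveℕ 3 (λ p m n → (p :⊛ (m :⊛ m)) :⊛ (n :⊛ n) :≡ (p :⊛ (n :⊛ n)) :⊛ (m :⊛ m)) refl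

suc/ : ∀ s n .{{_ : NonZero n}} → + suc s / n ≃ + s / n ℚ.+ + 1 / n
suc/ s (suc n) = *≡* (trans (sym (ℤ.pos-* (suc s) (suc n ℕ.* suc n)))
                   (trans (cong +_ (eq s (suc n))) (trans (ℤ.pos-* (s ℕ.* suc n ℕ.+ 1 ℕ.* suc n) (suc n))
                     (cong (ℤ._* + suc n) (trans (ℤ.pos-+ (s ℕ.* suc n) (1 ℕ.* suc n))
                       (cong₂ ℤ._+_ (ℤ.pos-* s (suc n)) (ℤ.pos-* 1 (suc n))))))))
  where
  open +-*-Solver renaming (solve to solveℕ; _:=_ to _:≡_; _:+_ to _:⊕_; _:*_ to _:⊛_)
  eq : ∀ s n → suc s ℕ.* (n ℕ.* n) ≡ (s ℕ.* n ℕ.+ 1 ℕ.* n) ℕ.* n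
  eq = solveℕ 2 (λ s n → (con 1 :⊕ s) :⊛ (n :⊛ n) :≡ (s :⊛ n :⊕ con 1 :⊛ n) :⊛ n) refl

cross⇒≤ : ∀ s t m n .{{_ : NonZero m}} .{{_ : NonZero n}} →
          s ℕ.* n ℕ.≤ t ℕ.* m → + s / m ℚ.≤ + t / n
cross⇒≤ s t (suc m) (suc n) h =
  *≤* (subst₂ ℤ._≤_ (ℤ.pos-* s (suc n)) (ℤ.pos-* t (suc m)) (ℤ.+≤+ h))

approx√-≤ : ∀ p d m n .{{_ : NonZero d}} .{{_ : NonZero m}} .{{_ : NonZero n}} →
            + approx√ p d m / m ℚ.≤ + approx√ p d n / n ℚ.+ + 1 / n
approx√-≤ p d m n = ℚ.≤-trans
  (cross⇒≤ (approx√ p d m) (suc (approx√ p d n)) m n (ℕ.<⇒≤ (approx√-cross p d m n)))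
  (ℚ.≤-reflexive (suc/ (approx√ p d n) n))

√ : (q : ℚᵘ) .{{_ : NonNegative q}} → ℝ
√ q .seq n = + approx√ ℤ.∣ ↥ q ∣ (↧ₙ q) n / n
√ q .reg m n = close
  (ℚ.≤-trans (approx√-≤ p d m n) (ℚ.+-monoʳ-≤ (+ approx√ p d n / n)
    (ℚ.≤-trans (ℚ.≤-reflexive (ℚ.≃-sym (ℚ.+-identityˡ (+ 1 / n)))) (ℚ.+-monoˡ-≤ (+ 1 / n) (0≤1/n m)))))
  (ℚ.≤-trans (approx√-≤ p d n m) (ℚ.+-monoʳ-≤ (+ approx√ p d m / m)
    (ℚ.≤-trans (ℚ.≤-reflexive (ℚ.≃-sym (ℚ.+-identityʳ (+ 1 / m)))) (ℚ.+-monoʳ-≤ (+ 1 / m) (0≤1/n n)))))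
  where
  p = ℤ.∣ ↥ q ∣
  d = ↧ₙ q

-- n^(-k/2) = √(1/nᵏ)

infix 8 _^-[_/2]

_^-[_/2] : (n k : ℕ) .{{_ : NonZero n}} → ℝ
n ^-[ k /2] = √ (+ 1 / (n ℕ.^ k)) {{nonNeg (n ℕ.^ k)}}
  where
  instance _ = ℕ.m^n≢0 n k
  nonNeg : ∀ d .{{_ : NonZero d}} → NonNegative (+ 1 / d)
  nonNeg (suc d) = _

------------------------------------------------------------------------
-- Distance to the nearest integer

-- For a rational q it is attained at ⌊q⌋ or ⌊q⌋ + 1.

‖_‖ℚ : ℚᵘ → ℚᵘ
‖ q ‖ℚ = ∣ q - ⌊ q ⌋ / 1 ∣ ℚ.⊓ ∣ q - ℤ.suc ⌊ q ⌋ / 1 ∣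

⌊q⌋≤q : ∀ q → ⌊ q ⌋ / 1 ℚ.≤ q
⌊q⌋≤q q@(mkℚᵘ n d) = *≤* (ℤ.≤-trans (ℤ.[n/d]*d≤n n (+ suc d)) (ℤ.≤-reflexive (sym (ℤ.*-identityʳ n))))

q≤⌊q⌋+1 : ∀ q → q ℚ.≤ ℤ.suc ⌊ q ⌋ / 1
q≤⌊q⌋+1 q@(mkℚᵘ n d) = *≤* (ℤ.≤-trans (ℤ.≤-reflexive (ℤ.*-identityʳ n)) (ℤ.<⇒≤
  (subst (λ m → n ℤ.< ℤ.suc m ℤ.* + suc d) (sym (ℤ.div-pos-is-/ℕ n (suc d))) (ℤ.n<s[n/ℕd]*d n (suc d)))))

ℤ/1-mono : ∀ {m n} → m ℤ.≤ n → m / 1 ℚ.≤ n / 1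
ℤ/1-mono m≤n = *≤* (ℤ.*-monoʳ-≤-nonNeg (+ 1) m≤n)

‖q‖≤∣q-m∣ : ∀ q m → ‖ q ‖ℚ ℚ.≤ ∣ q - m / 1 ∣
‖q‖≤∣q-m∣ q m with m ℤ.≤? ⌊ q ⌋
... | yes m≤⌊q⌋ = begin
  ‖ q ‖ℚ                ≤⟨ ℚ.p⊓q≤p ∣ q - ⌊ q ⌋ / 1 ∣ _ ⟩
  ∣ q - ⌊ q ⌋ / 1 ∣     ≃⟨ ℚ.0≤p⇒∣p∣≃p (ℚ.p≤q⇒0≤q-p (⌊q⌋≤q q)) ⟩
  q - ⌊ q ⌋ / 1         ≤⟨ ℚ.+-monoʳ-≤ q (ℚ.neg-mono-≤ (ℤ/1-mono m≤⌊q⌋)) ⟩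
  q - m / 1             ≤⟨ p≤∣p∣ (q - m / 1) ⟩
  ∣ q - m / 1 ∣         ∎
  where open ℚ.≤-Reasoning
... | no m≰⌊q⌋ = begin
  ‖ q ‖ℚ                        ≤⟨ ℚ.p⊓q≤q ∣ q - ⌊ q ⌋ / 1 ∣ _ ⟩
  ∣ q - ℤ.suc ⌊ q ⌋ / 1 ∣       ≃⟨ p≤q⇒∣p-q∣≃q-p (q≤⌊q⌋+1 q) ⟩
  ℤ.suc ⌊ q ⌋ / 1 - q           ≤⟨ ℚ.+-monoˡ-≤ (ℚ.- q) (ℤ/1-mono (ℤ.i<j⇒suc[i]≤j (ℤ.≰⇒> m≰⌊q⌋))) ⟩
  m / 1 - q                     ≤⟨ p≤∣p∣ (m / 1 - q) ⟩
  ∣ m / 1 - q ∣                 ≃⟨ ∣p-q∣≃∣q-p∣ (m / 1) q ⟩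
  ∣ q - m / 1 ∣                 ∎
  where open ℚ.≤-Reasoning

‖q‖-attained : ∀ q → ∃[ m ] ‖ q ‖ℚ ≃ ∣ q - m / 1 ∣
‖q‖-attained q with ℚ.⊓-sel ∣ q - ⌊ q ⌋ / 1 ∣ ∣ q - ℤ.suc ⌊ q ⌋ / 1 ∣
... | inj₁ eq = ⌊ q ⌋ , eq
... | inj₂ eq = ℤ.suc ⌊ q ⌋ , eq

‖p‖≤‖q‖+∣p-q∣ : ∀ p q → ‖ p ‖ℚ ℚ.≤ ‖ q ‖ℚ ℚ.+ ∣ p - q ∣
‖p‖≤‖q‖+∣p-q∣ p q with ‖q‖-attained q
... | m , ‖q‖≃ = begin
  ‖ p ‖ℚ                          ≤⟨ ‖q‖≤∣q-m∣ p m ⟩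
  ∣ p - m / 1 ∣                   ≤⟨ ∣p-r∣≤∣p-q∣+∣q-r∣ p q (m / 1) ⟩
  ∣ p - q ∣ ℚ.+ ∣ q - m / 1 ∣     ≃⟨ ℚ.+-comm ∣ p - q ∣ ∣ q - m / 1 ∣ ⟩
  ∣ q - m / 1 ∣ ℚ.+ ∣ p - q ∣     ≃⟨ ℚ.+-congˡ ∣ p - q ∣ (ℚ.≃-sym ‖q‖≃) ⟩
  ‖ q ‖ℚ ℚ.+ ∣ p - q ∣            ∎
  where open ℚ.≤-Reasoning

-- The distance on ℚ is 1-Lipschitz, so it extends to ℝ by applying it to
-- each approximation.

‖_‖ : ℝ → ℝ
‖ x ‖ .seq n = ‖ seq x n ‖ℚ
‖ x ‖ .reg m n = ℚ.≤-trans
  (close (‖p‖≤‖q‖+∣p-q∣ xₘ xₙ)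
         (ℚ.≤-trans (‖p‖≤‖q‖+∣p-q∣ xₙ xₘ) (ℚ.+-monoʳ-≤ ‖ xₘ ‖ℚ (ℚ.≤-reflexive (∣p-q∣≃∣q-p∣ xₙ xₘ)))))
  (reg x m n)
  where
  xₘ = seq x m
  xₙ = seq x n

{-# OPTIONS --safe #-}
module Submission where

-- For fixed b ∈ ℕ and s ∈ ℤ, √((N+b)² + 4s) = N + b + Σ_{i≥0} v_i / (N(N+1)⋯(N+i)) as N → ∞,
-- with integer coefficients v_i.  Suppose some nonnegative combination of these expansions has
-- leading term c / (N⋯(N+m)), c > 0, and another has leading term −c / (N⋯(N+m)).  Adding a
-- translate (b ↦ b + B) of the second to the first cancels the leading terms, and for large B the
-- sign of the next one is determined by B; exchanging the roles gives the other sign.  So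
-- all orders and both signs occur.  By Carathéodory's theorem for cones, applied to the first k
-- coefficients, k square roots suffice for a combination Σ x_j √((N+b_j)² + 4s_j) which is an
-- integer plus c N^(-k) (1 + O(1/N)) with c > 0 constant.  Its terms are the square roots of the
-- integers x_j² ((N+b_j)² + 4s_j) = O(N²), so N of order √n gives the theorem.

open import Algebra.Properties.CommutativeMonoid.Sum using (sum-remove; ∑-distrib-+)
import Algebra.Properties.Semiring.Sum as SemiringSum
open import Data.Fin.Base using (Fin; zero; suc; punchIn)
import Data.Fin.Properties as Fin
open import Data.Integer.Base as ℤ using (ℤ; +_; -[1+_]; 0ℤ; 1ℤ; ∣_∣)
import Data.Integer.Properties as ℤ
open import Data.Integer.Tactic.RingSolver using (solve-∀)
open import Data.List.Base using (List; []; _∷_; _++_; map)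
open import Data.Nat.Base as ℕ using (ℕ; zero; suc; _≤_; _<_; _^_; NonZero; s≤s; z≤n)
import Data.Nat.DivMod as ℕ
import Data.Nat.Properties as ℕ
import Data.Nat.Tactic.RingSolver as ℕSolver
open import Data.Product.Base using (∃-syntax; Σ-syntax; _×_; _,_; proj₁; proj₂)
open import Data.Rational.Unnormalised.Base as ℚ
  using (ℚᵘ; 0ℚᵘ; _/_; _≃_; *≡*; *≤*; *<*; ↥_; ↧ₙ_)
import Data.Rational.Unnormalised.Properties as ℚ
import Data.Rational.Unnormalised.Solver as ℚSolver
open import Data.Sum.Base using (_⊎_; inj₁; inj₂)
open import Data.Vec.Functional using (insertAt) renaming (_∷_ to _◂_)
open import Data.Vec.Functional.Properties using (insertAt-lookup; insertAt-punchIn)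
open import Relation.Binary.PropositionalEquality
open import Relation.Nullary using (yes; no; contradiction)
open import Relation.Nullary.Decidable using (¬?; decidable-stable)
open import Defs

-- The square roots can only be added, with `x√r = √(x²r)` for `x ≥ 0`, so cancelling the first
-- `k - 1` coefficients is a question about cones and not about linear spans. That is why the
-- induction on the order carries both signs, and why the number of roots is cut down by
-- Carathéodory's theorem. Rising factorials replace powers of `N` because translation then moves
-- each coefficient only into the next one, with the integer factor `i + 1`; they also give the
-- first `k` terms the common denominator `rising k N`. The factor 4 in the radicand keeps the
-- coefficients integral. Positivity of the distance comes from integrality: the truncated sum is an
-- integer plus `c / rising k N` with an integer `c ≥ 1`, and the tails are smaller than this by a
-- factor of order `N`. For `n` too small to allow such an `N`, the sum `√2 + 1 + ⋯ + 1` and a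
-- larger constant suffice.

module ℕΣ = SemiringSum ℕ.+-*-semiring
module ℤΣ = SemiringSum ℤ.+-*-semiring
open ℤΣ using (sum; sum-cong-≗)

-- Integer polynomials and explicit growth bounds

IsPoly : ℕ → (ℕ → ℤ) → Set
IsPoly zero    f = ∀ N → f N ≡ 0ℤ
IsPoly (suc d) f = ∃[ ℓ ] ∃[ g ] IsPoly d g × (∀ N → f N ≡ ℓ ℤ.* + (N ^ d) ℤ.+ g N)

-- The index of `IsPoly` is a strict bound on the degree, so this is the coefficient of `N ^ d` and
-- may be 0. It is kept as data because the expansion coefficients are read off from it.
lead : ∀ {d f} → IsPoly (suc d) f → ℤ
lead = proj₁

poly-cong : ∀ {d f g} → (∀ N → f N ≡ g N) → IsPoly d g → IsPoly d f
poly-cong {zero}  e p             N = trans (e N) (p N)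
poly-cong {suc d} e (ℓ , r , p , q) = ℓ , r , p , λ N → trans (e N) (q N)

poly-const : ∀ c → IsPoly 1 (λ _ → c)
poly-const c = c , (λ _ → 0ℤ) , (λ _ → refl) , λ _ → aux c
  where
  aux : ∀ c → c ≡ c ℤ.* 1ℤ ℤ.+ 0ℤ
  aux = solve-∀

poly-weaken : ∀ {d f} → IsPoly d f → IsPoly (suc d) f
poly-weaken {d} {f} p = 0ℤ , f , p , λ N → aux (+ (N ^ d)) (f N)
  where
  aux : ∀ m y → y ≡ 0ℤ ℤ.* m ℤ.+ y
  aux = solve-∀

poly-weaken* : ∀ {f} d → IsPoly 1 f → IsPoly (suc d) f
poly-weaken* zero    p = p
poly-weaken* (suc d) p = poly-weaken (poly-weaken* d p)

poly-+ : ∀ {d f g} → IsPoly d f → IsPoly d g → IsPoly d (λ N → f N ℤ.+ g N)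
poly-+ {zero}  p q N = cong₂ ℤ._+_ (p N) (q N)
poly-+ {suc d} (ℓ , r , p , e) (ℓ′ , r′ , p′ , e′) =
  ℓ ℤ.+ ℓ′ , _ , poly-+ p p′ ,
  λ N → trans (cong₂ ℤ._+_ (e N) (e′ N)) (aux ℓ ℓ′ (+ (N ^ d)) (r N) (r′ N))
  where
  aux : ∀ a b m x y → (a ℤ.* m ℤ.+ x) ℤ.+ (b ℤ.* m ℤ.+ y) ≡ (a ℤ.+ b) ℤ.* m ℤ.+ (x ℤ.+ y)
  aux = solve-∀

poly-scale : ∀ {d f} c → IsPoly d f → IsPoly d (λ N → c ℤ.* f N)
poly-scale {zero}  c p N = trans (cong (c ℤ.*_) (p N)) (ℤ.*-zeroʳ c)
poly-scale {suc d} c (ℓ , r , p , e) =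
  c ℤ.* ℓ , _ , poly-scale c p , λ N → trans (cong (c ℤ.*_) (e N)) (aux c ℓ (+ (N ^ d)) (r N))
  where
  aux : ∀ c a m x → c ℤ.* (a ℤ.* m ℤ.+ x) ≡ (c ℤ.* a) ℤ.* m ℤ.+ c ℤ.* x
  aux = solve-∀

poly-N* : ∀ {d f} → IsPoly d f → IsPoly (suc d) (λ N → + N ℤ.* f N)
poly-N* {zero}  p = 0ℤ , (λ _ → 0ℤ) , (λ _ → refl) , λ N → trans (cong (+ N ℤ.*_) (p N)) (ℤ.*-zeroʳ (+ N))
poly-N* {suc d} (ℓ , r , p , e) =
  ℓ , _ , poly-N* p , λ N → trans (cong (+ N ℤ.*_) (e N))
    (trans (aux ℓ (+ N) (+ (N ^ d)) (r N)) (cong (λ m → ℓ ℤ.* m ℤ.+ + N ℤ.* r N) (sym (ℤ.pos-* N (N ^ d)))))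
  where
  aux : ∀ a n m x → n ℤ.* (a ℤ.* m ℤ.+ x) ≡ a ℤ.* (n ℤ.* m) ℤ.+ n ℤ.* x
  aux = solve-∀

poly-[N+c]* : ∀ {d f} c → IsPoly d f → IsPoly (suc d) (λ N → + (N ℕ.+ c) ℤ.* f N)
poly-[N+c]* {f = f} c p = poly-cong
  (λ N → trans (cong (ℤ._* f N) (ℤ.pos-+ N c)) (ℤ.*-distribʳ-+ (f N) (+ N) (+ c)))
  (poly-+ (poly-N* p) (poly-weaken (poly-scale (+ c) p)))

poly-N^ : ∀ d → IsPoly (suc d) (λ N → + (N ^ d))
poly-N^ zero    = poly-const 1ℤ
poly-N^ (suc d) = poly-cong (λ N → ℤ.pos-* N (N ^ d)) (poly-N* (poly-N^ d))

-- The constant is stored and valid from `N = 1` on; thresholds and error terms are later computed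
-- from it, which makes the final constant effective.
record O (d : ℕ) (f : ℕ → ℤ) : Set where
  constructor _,_
  field
    constant : ℕ
    bounded  : ∀ N .{{_ : ℕ.NonZero N}} → ∣ f N ∣ ≤ constant ℕ.* N ^ d

O-cong : ∀ {d f g} → (∀ N → f N ≡ g N) → O d g → O d f
O-cong e (E , h) = E , λ N → subst (λ z → ∣ z ∣ ≤ _) (sym (e N)) (h N)

O-+ : ∀ {d f g} → O d f → O d g → O d (λ N → f N ℤ.+ g N)
O-+ {d} {f} {g} (E , h) (F , h′) = E ℕ.+ F , λ N → begin
  ∣ f N ℤ.+ g N ∣               ≤⟨ ℤ.∣i+j∣≤∣i∣+∣j∣ (f N) (g N) ⟩
  ∣ f N ∣ ℕ.+ ∣ g N ∣           ≤⟨ ℕ.+-mono-≤ (h N) (h′ N) ⟩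
  E ℕ.* N ^ d ℕ.+ F ℕ.* N ^ d   ≡⟨ ℕ.*-distribʳ-+ (N ^ d) E F ⟨
  (E ℕ.+ F) ℕ.* N ^ d           ∎
  where open ℕ.≤-Reasoning

O-* : ∀ {d e f g} → O d f → O e g → O (d ℕ.+ e) (λ N → f N ℤ.* g N)
O-* {d} {e} {f} {g} (E , h) (F , h′) = E ℕ.* F , λ N → begin
  ∣ f N ℤ.* g N ∣                     ≡⟨ ℤ.abs-* (f N) (g N) ⟩
  ∣ f N ∣ ℕ.* ∣ g N ∣                 ≤⟨ ℕ.*-mono-≤ (h N) (h′ N) ⟩
  E ℕ.* N ^ d ℕ.* (F ℕ.* N ^ e)       ≡⟨ aux E F (N ^ d) (N ^ e) ⟩
  E ℕ.* F ℕ.* (N ^ d ℕ.* N ^ e)       ≡⟨ cong (E ℕ.* F ℕ.*_) (ℕ.^-distribˡ-+-* N d e) ⟨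
  E ℕ.* F ℕ.* N ^ (d ℕ.+ e)           ∎
  where
  open ℕ.≤-Reasoning
  aux : ∀ a b x y → a ℕ.* x ℕ.* (b ℕ.* y) ≡ a ℕ.* b ℕ.* (x ℕ.* y)
  aux = ℕSolver.solve-∀

O-const : ∀ c → O 0 (λ _ → c)
O-const c = ∣ c ∣ , λ N → ℕ.≤-reflexive (sym (ℕ.*-identityʳ ∣ c ∣))

O-weaken : ∀ {d f} → O d f → O (suc d) f
O-weaken {d} {f} (E , h) = E , λ N → ℕ.≤-trans (h N) (ℕ.*-monoʳ-≤ E (ℕ.m≤n*m (N ^ d) N))

O-weaken* : ∀ {f} d → O 0 f → O d f
O-weaken* zero    h = h
O-weaken* (suc d) h = O-weaken (O-weaken* d h)

O-N+c : ∀ c → O 1 (λ N → + (N ℕ.+ c))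
O-N+c c = suc c , λ N → begin
  N ℕ.+ c             ≤⟨ ℕ.+-monoʳ-≤ N (ℕ.m≤m*n c N) ⟩
  N ℕ.+ c ℕ.* N       ≡⟨ cong (suc c ℕ.*_) (ℕ.*-identityʳ N) ⟨
  suc c ℕ.* N ^ 1     ∎
  where open ℕ.≤-Reasoning

^-distribʳ-* : ∀ m n d → (m ℕ.* n) ^ d ≡ m ^ d ℕ.* n ^ d
^-distribʳ-* m n zero    = refl
^-distribʳ-* m n (suc d) = trans (cong (m ℕ.* n ℕ.*_) (^-distribʳ-* m n d)) (ℕ.[m*n]*[o*p]≡[m*o]*[n*p] m n (m ^ d) (n ^ d))

O-shift : ∀ {d f} → O d f → O d (λ N → f (suc N))
O-shift {d} {f} (E , h) = E ℕ.* 2 ^ d , λ N → begin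
  ∣ f (suc N) ∣              ≤⟨ h (suc N) ⟩
  E ℕ.* suc N ^ d            ≤⟨ ℕ.*-monoʳ-≤ E (ℕ.^-monoˡ-≤ d (1+N≤2N N)) ⟩
  E ℕ.* (2 ℕ.* N) ^ d        ≡⟨ cong (E ℕ.*_) (^-distribʳ-* 2 N d) ⟩
  E ℕ.* (2 ^ d ℕ.* N ^ d)    ≡⟨ ℕ.*-assoc E (2 ^ d) (N ^ d) ⟨
  E ℕ.* 2 ^ d ℕ.* N ^ d      ∎
  where
  open ℕ.≤-Reasoning
  1+N≤2N : ∀ N .{{_ : ℕ.NonZero N}} → suc N ≤ 2 ℕ.* N
  1+N≤2N (suc N) = subst (suc (suc N) ≤_) (cong (suc N ℕ.+_) (sym (ℕ.+-identityʳ (suc N)))) (ℕ.s≤s (ℕ.m≤n+m (suc N) N))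

poly⇒O : ∀ {d f} → IsPoly (suc d) f → O d f
poly⇒O {zero}  (ℓ , r , p , e) = O-cong (λ N → trans (e N) (trans (cong (λ z → ℓ ℤ.* 1ℤ ℤ.+ z) (p N)) (aux ℓ))) (O-const ℓ)
  where
  aux : ∀ c → c ℤ.* 1ℤ ℤ.+ 0ℤ ≡ c
  aux = solve-∀
poly⇒O {suc d} (ℓ , r , p , e) = O-cong e (O-+ (O-* (O-const ℓ) (1 , λ N → ℕ.≤-reflexive (sym (ℕ.+-identityʳ (N ^ suc d)))))
                                             (O-weaken (poly⇒O p)))

-- Expansions in inverse rising factorials

rising : ℕ → ℕ → ℕ
rising zero    N = 1
rising (suc i) N = (N ℕ.+ i) ℕ.* rising i N

-- numerator v k N / rising k N = Σ_{i<k} v i / (N(N+1)⋯(N+i))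
numerator : (ℕ → ℤ) → ℕ → ℕ → ℤ
numerator v zero    N = 0ℤ
numerator v (suc i) N = + (N ℕ.+ i) ℤ.* numerator v i N ℤ.+ v i

rising-monic : ∀ i → ∃[ μ ] IsPoly i μ × (∀ N → + rising i N ≡ + (N ^ i) ℤ.+ μ N)
rising-monic zero = (λ _ → 0ℤ) , (λ _ → refl) , λ N → refl
rising-monic (suc i) with rising-monic i
... | μ , p , e = _ , poly-+ (poly-scale (+ i) (poly-N^ i)) (poly-[N+c]* i p) , λ N → begin
  + rising (suc i) N                                                ≡⟨ ℤ.pos-* (N ℕ.+ i) (rising i N) ⟩
  + (N ℕ.+ i) ℤ.* + rising i N                                      ≡⟨ cong (+ (N ℕ.+ i) ℤ.*_) (e N) ⟩
  (+ (N ℕ.+ i)) ℤ.* (+ (N ^ i) ℤ.+ μ N)                          ≡⟨ ℤ.*-distribˡ-+ (+ (N ℕ.+ i)) (+ (N ^ i)) (μ N) ⟩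
  (+ N ℤ.+ + i) ℤ.* + (N ^ i) ℤ.+ + (N ℕ.+ i) ℤ.* μ N          ≡⟨ aux (+ N) (+ i) (+ (N ^ i)) (+ (N ℕ.+ i) ℤ.* μ N) ⟩
  + N ℤ.* + (N ^ i) ℤ.+ (+ i ℤ.* + (N ^ i) ℤ.+ + (N ℕ.+ i) ℤ.* μ N) ≡⟨ cong (ℤ._+ (+ i ℤ.* + (N ^ i) ℤ.+ + (N ℕ.+ i) ℤ.* μ N)) (ℤ.pos-* N (N ^ i)) ⟨
  + (N ^ suc i) ℤ.+ (+ i ℤ.* + (N ^ i) ℤ.+ + (N ℕ.+ i) ℤ.* μ N) ∎
  where
  open ≡-Reasoning
  aux : ∀ n i m x → (n ℤ.+ i) ℤ.* m ℤ.+ x ≡ n ℤ.* m ℤ.+ (i ℤ.* m ℤ.+ x)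
  aux = solve-∀

-- This is `m²` times the error in the radicand when `y + q/m` is taken for `√(y² + 4s)`.
defect : ℤ → ℤ → ℤ → ℤ → ℤ
defect s m y q = m ℤ.* m ℤ.* (y ℤ.* y ℤ.+ + 4 ℤ.* s) ℤ.- (m ℤ.* y ℤ.+ q) ℤ.* (m ℤ.* y ℤ.+ q)

-- The coefficient v_i is determined by lowering the degree of the defect: if it is 4ρ with
-- ρ = ℓ N^i + ⋯, then v_i = 2ℓ.
record Stage (s : ℤ) (i : ℕ) : Set where
  field
    q ρ    : ℕ → ℤ
    q-poly : IsPoly i q
    ρ-poly : IsPoly (suc i) ρ
    eq     : ∀ N → defect s (+ rising i N) (+ N) (q N) ≡ + 4 ℤ.* ρ N

  ℓ = lead ρ-poly

-- Appending a coefficient `v` turns the defect into `c² · defect - 2vc(mn + q) - v²` with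
-- `c = N + i`. The terms in `N^(i+2)` have coefficients `4ℓ` and `-2v`, so `v = 2ℓ` removes them.
-- What remains is again divisible by 4, which keeps the next `v` integral; the defect at the start
-- is `4s`.
stage : ∀ s i → Stage s i
stage s zero = record
  { q = λ _ → 0ℤ ; ρ = λ _ → s ; q-poly = λ _ → refl ; ρ-poly = poly-const s ; eq = λ N → aux (+ N) s }
  where
  aux : ∀ n s → 1ℤ ℤ.* 1ℤ ℤ.* (n ℤ.* n ℤ.+ + 4 ℤ.* s) ℤ.- (1ℤ ℤ.* n ℤ.+ 0ℤ) ℤ.* (1ℤ ℤ.* n ℤ.+ 0ℤ) ≡ + 4 ℤ.* s
  aux = solve-∀
stage s (suc i) = record
  { q      = λ N → + (N ℕ.+ i) ℤ.* S.q N ℤ.+ + 2 ℤ.* ℓ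
  ; ρ      = ρ′
  ; q-poly = poly-+ (poly-[N+c]* i S.q-poly) (poly-weaken* i (poly-const (+ 2 ℤ.* ℓ)))
  ; ρ-poly = poly-+ (poly-+ (poly-+ (poly-+
      (poly-scale (ℓ ℤ.* + i) (poly-[N+c]* i (poly-N^ i)))
      (poly-[N+c]* i (poly-[N+c]* i r-poly)))
      (poly-scale (ℤ.- ℓ) (poly-[N+c]* i (poly-N* μ-poly))))
      (poly-weaken (poly-scale (ℤ.- ℓ) (poly-[N+c]* i S.q-poly))))
      (poly-weaken* (suc i) (poly-const (ℤ.- (ℓ ℤ.* ℓ))))
  ; eq     = eq′
  }
  where
  module S = Stage (stage s i)
  ℓ = S.ℓ
  r = proj₁ (proj₂ S.ρ-poly)
  r-poly = proj₁ (proj₂ (proj₂ S.ρ-poly))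
  ρ-eq = proj₂ (proj₂ (proj₂ S.ρ-poly))
  μ = proj₁ (rising-monic i)
  μ-poly = proj₁ (proj₂ (rising-monic i))
  rising-eq = proj₂ (proj₂ (rising-monic i))
  ρ′ : ℕ → ℤ
  ρ′ N = ℓ ℤ.* + i ℤ.* (+ (N ℕ.+ i) ℤ.* + (N ^ i)) ℤ.+ + (N ℕ.+ i) ℤ.* (+ (N ℕ.+ i) ℤ.* r N)
     ℤ.+ ℤ.- ℓ ℤ.* (+ (N ℕ.+ i) ℤ.* (+ N ℤ.* μ N)) ℤ.+ ℤ.- ℓ ℤ.* (+ (N ℕ.+ i) ℤ.* S.q N) ℤ.+ ℤ.- (ℓ ℤ.* ℓ)
  ring₁ : ∀ c m n s q ℓ → let w = c ℤ.* m ℤ.* n ℤ.+ (c ℤ.* q ℤ.+ + 2 ℤ.* ℓ) in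
    c ℤ.* m ℤ.* (c ℤ.* m) ℤ.* (n ℤ.* n ℤ.+ + 4 ℤ.* s) ℤ.- w ℤ.* w ≡
    c ℤ.* c ℤ.* (m ℤ.* m ℤ.* (n ℤ.* n ℤ.+ + 4 ℤ.* s) ℤ.- (m ℤ.* n ℤ.+ q) ℤ.* (m ℤ.* n ℤ.+ q))
      ℤ.- + 4 ℤ.* (ℓ ℤ.* c ℤ.* (m ℤ.* n ℤ.+ q) ℤ.+ ℓ ℤ.* ℓ)
  ring₁ = solve-∀
  -- Here `z` is `N ^ i`. The two top terms leave `ℓcz(c - n) = ℓicz`, of degree only `i + 1`.
  ring₂ : ∀ n i z μ q ℓ r → let c = n ℤ.+ i in
    c ℤ.* c ℤ.* (+ 4 ℤ.* (ℓ ℤ.* z ℤ.+ r)) ℤ.- + 4 ℤ.* (ℓ ℤ.* c ℤ.* ((z ℤ.+ μ) ℤ.* n ℤ.+ q) ℤ.+ ℓ ℤ.* ℓ) ≡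
    + 4 ℤ.* (ℓ ℤ.* i ℤ.* (c ℤ.* z) ℤ.+ c ℤ.* (c ℤ.* r)
     ℤ.+ ℤ.- ℓ ℤ.* (c ℤ.* (n ℤ.* μ)) ℤ.+ ℤ.- ℓ ℤ.* (c ℤ.* q) ℤ.+ ℤ.- (ℓ ℤ.* ℓ))
  ring₂ = solve-∀
  eq′ : ∀ N → defect s (+ rising (suc i) N) (+ N) (+ (N ℕ.+ i) ℤ.* S.q N ℤ.+ + 2 ℤ.* ℓ) ≡ + 4 ℤ.* ρ′ N
  eq′ N = begin
    defect s (+ rising (suc i) N) n (c ℤ.* S.q N ℤ.+ + 2 ℤ.* ℓ)
      ≡⟨ cong (λ m → defect s m n (c ℤ.* S.q N ℤ.+ + 2 ℤ.* ℓ)) (ℤ.pos-* (N ℕ.+ i) (rising i N)) ⟩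
    defect s (c ℤ.* + rising i N) n (c ℤ.* S.q N ℤ.+ + 2 ℤ.* ℓ)
      ≡⟨ ring₁ c (+ rising i N) n s (S.q N) ℓ ⟩
    c ℤ.* c ℤ.* defect s (+ rising i N) n (S.q N) ℤ.- + 4 ℤ.* (ℓ ℤ.* c ℤ.* (+ rising i N ℤ.* n ℤ.+ S.q N) ℤ.+ ℓ ℤ.* ℓ)
      ≡⟨ cong₂ (λ x m → c ℤ.* c ℤ.* x ℤ.- + 4 ℤ.* (ℓ ℤ.* c ℤ.* (m ℤ.* n ℤ.+ S.q N) ℤ.+ ℓ ℤ.* ℓ))
           (trans (S.eq N) (cong (+ 4 ℤ.*_) (ρ-eq N))) (rising-eq N) ⟩
    c ℤ.* c ℤ.* (+ 4 ℤ.* (ℓ ℤ.* + (N ^ i) ℤ.+ r N))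
      ℤ.- + 4 ℤ.* (ℓ ℤ.* c ℤ.* ((+ (N ^ i) ℤ.+ μ N) ℤ.* n ℤ.+ S.q N) ℤ.+ ℓ ℤ.* ℓ)
      ≡⟨ ring₂ n (+ i) (+ (N ^ i)) (μ N) (S.q N) ℓ (r N) ⟩
    + 4 ℤ.* ρ′ N ∎
    where
    open ≡-Reasoning
    n = + N
    c = + (N ℕ.+ i)

-- For e_i(N) = 1/(N(N+1)⋯(N+i)) one has e_i(N+1) = e_i(N) − (i+1) e_{i+1}(N), so shiftCoefs v
-- are the coefficients of the translate by 1 of the expansion with coefficients v.
last : (ℕ → ℤ) → ℕ → ℤ
last v zero    = 0ℤ
last v (suc j) = + suc j ℤ.* v j

shiftCoefs : (ℕ → ℤ) → ℕ → ℤ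
shiftCoefs v k = v k ℤ.- last v k

coef : ℤ → ℕ → ℕ → ℤ
coef s zero    i = + 2 ℤ.* Stage.ℓ (stage s i)
coef s (suc b) = shiftCoefs (coef s b)

stage-q : ∀ s i N → Stage.q (stage s i) N ≡ numerator (coef s 0) i N
stage-q s zero    N = refl
stage-q s (suc i) N = cong (λ z → + (N ℕ.+ i) ℤ.* z ℤ.+ coef s 0 i) (stage-q s i N)

rising-shift : ∀ k N → N ℕ.* rising k (suc N) ≡ (N ℕ.+ k) ℕ.* rising k N
rising-shift zero    N = cong (ℕ._* 1) (sym (ℕ.+-identityʳ N))
rising-shift (suc k) N = begin
  N ℕ.* ((suc N ℕ.+ k) ℕ.* rising k (suc N))   ≡⟨ aux N k (rising k (suc N)) ⟩
  (N ℕ.+ suc k) ℕ.* (N ℕ.* rising k (suc N))   ≡⟨ cong ((N ℕ.+ suc k) ℕ.*_) (rising-shift k N) ⟩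
  (N ℕ.+ suc k) ℕ.* rising (suc k) N           ∎
  where
  open ≡-Reasoning
  aux : ∀ n k m → n ℕ.* ((1 ℕ.+ n ℕ.+ k) ℕ.* m) ≡ (n ℕ.+ (1 ℕ.+ k)) ℕ.* (n ℕ.* m)
  aux = ℕSolver.solve-∀

-- Divided by `N(N+1)⋯(N+k)`, this is the translation rule for partial sums. Truncation does not
-- commute with translation: the last kept term spills into the first dropped one, and `last v k` is
-- that spill.
numerator-shift : ∀ v k N → + N ℤ.* numerator v k (suc N) ≡ + (N ℕ.+ k) ℤ.* numerator (shiftCoefs v) k N ℤ.- last v k
numerator-shift v zero    N = trans (ℤ.*-zeroʳ (+ N)) (sym (cong (ℤ._- 0ℤ) (ℤ.*-zeroʳ (+ (N ℕ.+ 0)))))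
numerator-shift v (suc k) N = begin
  + N ℤ.* (+ (suc N ℕ.+ k) ℤ.* numerator v k (suc N) ℤ.+ v k)
    ≡⟨ ring₁ (+ N) (+ k) (numerator v k (suc N)) (v k) ⟩
  (1ℤ ℤ.+ (+ N ℤ.+ + k)) ℤ.* (+ N ℤ.* numerator v k (suc N)) ℤ.+ + N ℤ.* v k
    ≡⟨ cong (λ z → (1ℤ ℤ.+ (+ N ℤ.+ + k)) ℤ.* z ℤ.+ + N ℤ.* v k) (numerator-shift v k N) ⟩
  (1ℤ ℤ.+ (+ N ℤ.+ + k)) ℤ.* ((+ N ℤ.+ + k) ℤ.* numerator (shiftCoefs v) k N ℤ.- last v k) ℤ.+ + N ℤ.* v k
    ≡⟨ ring₂ (+ N) (+ k) (numerator (shiftCoefs v) k N) (last v k) (v k) ⟩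
  + (N ℕ.+ suc k) ℤ.* (+ (N ℕ.+ k) ℤ.* numerator (shiftCoefs v) k N ℤ.+ shiftCoefs v k) ℤ.- + suc k ℤ.* v k ∎
  where
  open ≡-Reasoning
  ring₁ : ∀ n k q v → n ℤ.* ((1ℤ ℤ.+ (n ℤ.+ k)) ℤ.* q ℤ.+ v) ≡ (1ℤ ℤ.+ (n ℤ.+ k)) ℤ.* (n ℤ.* q) ℤ.+ n ℤ.* v
  ring₁ = solve-∀
  ring₂ : ∀ n k q l v → (1ℤ ℤ.+ (n ℤ.+ k)) ℤ.* ((n ℤ.+ k) ℤ.* q ℤ.- l) ℤ.+ n ℤ.* v
        ≡ (n ℤ.+ (1ℤ ℤ.+ k)) ℤ.* ((n ℤ.+ k) ℤ.* q ℤ.+ (v ℤ.- l)) ℤ.- (1ℤ ℤ.+ k) ℤ.* v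
  ring₂ = solve-∀

-- Error of the truncated expansions

approximant : (ℕ → ℤ) → ℕ → ℕ → ℕ → ℤ
approximant v b k N = + rising k N ℤ.* + (N ℕ.+ b) ℤ.+ numerator v k N

O-rising : ∀ k → O k (λ N → + rising k N)
O-rising zero    = O-const 1ℤ
O-rising (suc k) = O-cong (λ N → ℤ.pos-* (N ℕ.+ k) (rising k N)) (O-* (O-N+c k) (O-rising k))

O-numerator : ∀ v k → O k (numerator v k)
O-numerator v zero    = O-const 0ℤ
O-numerator v (suc k) = O-+ (O-* (O-N+c k) (O-numerator v k)) (O-weaken* (suc k) (O-const (v k)))

O-approximant : ∀ v b k → O (suc k) (approximant v b k)
O-approximant v b k = O-+ (O-cong (λ N → ℤ.*-comm (+ rising k N) (+ (N ℕ.+ b))) (O-* (O-N+c b) (O-rising k))) (O-weaken (O-numerator v k))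

residual : ℤ → (ℕ → ℤ) → ℕ → ℕ → ℕ → ℤ
residual s v b k N = defect s (+ rising k N) (+ (N ℕ.+ b)) (numerator v k N)

O-cancel-[N+c]² : ∀ {d f} c → O (2 ℕ.+ d) (λ N → + (N ℕ.+ c) ℤ.* + (N ℕ.+ c) ℤ.* f N) → O d f
O-cancel-[N+c]² {d} {f} c (E , h) = E , λ N → ℕ.*-cancelˡ-≤ (N ℕ.* N) {{ℕ.m*n≢0 N N}} (begin
  N ℕ.* N ℕ.* ∣ f N ∣                                 ≤⟨ ℕ.*-monoˡ-≤ ∣ f N ∣ (ℕ.*-mono-≤ (ℕ.m≤m+n N c) (ℕ.m≤m+n N c)) ⟩
  (N ℕ.+ c) ℕ.* (N ℕ.+ c) ℕ.* ∣ f N ∣                 ≡⟨ cong (λ z → ∣ z ∣ ℕ.* ∣ f N ∣) (ℤ.pos-* (N ℕ.+ c) (N ℕ.+ c)) ⟩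
  ∣ + (N ℕ.+ c) ℤ.* + (N ℕ.+ c) ∣ ℕ.* ∣ f N ∣         ≡⟨ ℤ.abs-* (+ (N ℕ.+ c) ℤ.* + (N ℕ.+ c)) (f N) ⟨
  ∣ + (N ℕ.+ c) ℤ.* + (N ℕ.+ c) ℤ.* f N ∣             ≤⟨ h N ⟩
  E ℕ.* (N ℕ.* (N ℕ.* N ^ d))                         ≡⟨ aux E N (N ^ d) ⟩
  N ℕ.* N ℕ.* (E ℕ.* N ^ d)                           ∎)
  where
  open ℕ.≤-Reasoning
  aux : ∀ e n z → e ℕ.* (n ℕ.* (n ℕ.* z)) ≡ n ℕ.* n ℕ.* (e ℕ.* z)
  aux = ℕSolver.solve-∀

-- As the approximant grows like `N ^ (k + 1)`, this puts it within `O(1/N)` of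
-- `rising k N · √((N+b)² + 4s)`, the size of the first dropped term. For `b = 0` it is the degree
-- bound in `stage`. A translation adds terms with the factor `last v k`; everything is `O(N^(k+2))`
-- before the division by `(N + k)²`.
O-residual : ∀ s b k → O k (residual s (coef s b) b k)
O-residual s zero k = O-cong eq (O-* (O-const (+ 4)) (poly⇒O S.ρ-poly))
  where
  module S = Stage (stage s k)
  eq : ∀ N → residual s (coef s 0) 0 k N ≡ + 4 ℤ.* S.ρ N
  eq N = trans (cong₂ (defect s (+ rising k N)) (cong +_ (ℕ.+-identityʳ N)) (sym (stage-q s k N))) (S.eq N)
O-residual s (suc b) k = O-cancel-[N+c]² k (O-cong eq (O-+ (O-+
    (O-* (O-* O-N O-N) (O-shift (O-residual s b k)))
    (O-* (O-const (ℤ.- (+ 2 ℤ.* c))) (O-* (O-N+c k) (O-approximant (shiftCoefs v) (suc b) k))))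
    (O-weaken* (2 ℕ.+ k) (O-const (c ℤ.* c)))))
  where
  v = coef s b
  c = last v k
  O-N : O 1 (λ N → + N)
  O-N = O-cong (λ N → cong +_ (sym (ℕ.+-identityʳ N))) (O-N+c 0)
  ring₁ : ∀ K m y s q c →
    K ℤ.* K ℤ.* (m ℤ.* m ℤ.* (y ℤ.* y ℤ.+ + 4 ℤ.* s) ℤ.- (m ℤ.* y ℤ.+ q) ℤ.* (m ℤ.* y ℤ.+ q)) ≡
    K ℤ.* m ℤ.* (K ℤ.* m) ℤ.* (y ℤ.* y ℤ.+ + 4 ℤ.* s)
      ℤ.- (K ℤ.* m ℤ.* y ℤ.+ (K ℤ.* q ℤ.- c)) ℤ.* (K ℤ.* m ℤ.* y ℤ.+ (K ℤ.* q ℤ.- c))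
      ℤ.+ ℤ.- (+ 2 ℤ.* c) ℤ.* (K ℤ.* (m ℤ.* y ℤ.+ q)) ℤ.+ c ℤ.* c
  ring₁ = solve-∀
  ring₂ : ∀ n m y s q →
    n ℤ.* m ℤ.* (n ℤ.* m) ℤ.* (y ℤ.* y ℤ.+ + 4 ℤ.* s) ℤ.- (n ℤ.* m ℤ.* y ℤ.+ n ℤ.* q) ℤ.* (n ℤ.* m ℤ.* y ℤ.+ n ℤ.* q) ≡
    n ℤ.* n ℤ.* (m ℤ.* m ℤ.* (y ℤ.* y ℤ.+ + 4 ℤ.* s) ℤ.- (m ℤ.* y ℤ.+ q) ℤ.* (m ℤ.* y ℤ.+ q))
  ring₂ = solve-∀
  eq : ∀ N → + (N ℕ.+ k) ℤ.* + (N ℕ.+ k) ℤ.* residual s (shiftCoefs v) (suc b) k N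
     ≡ + N ℤ.* + N ℤ.* residual s v b k (suc N)
       ℤ.+ ℤ.- (+ 2 ℤ.* c) ℤ.* (+ (N ℕ.+ k) ℤ.* approximant (shiftCoefs v) (suc b) k N) ℤ.+ c ℤ.* c
  eq N = begin
    K ℤ.* K ℤ.* defect s m y q
      ≡⟨ ring₁ K m y s q c ⟩
    defect s (K ℤ.* m) y (K ℤ.* q ℤ.- c) ℤ.+ e ℤ.+ c ℤ.* c
      ≡⟨ cong₂ (λ a b → defect s a y b ℤ.+ e ℤ.+ c ℤ.* c) m-eq (numerator-shift v k N) ⟨
    defect s (n ℤ.* m₁) y (n ℤ.* q₁) ℤ.+ e ℤ.+ c ℤ.* c
      ≡⟨ cong (λ z → z ℤ.+ e ℤ.+ c ℤ.* c) (ring₂ n m₁ y s q₁) ⟩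
    n ℤ.* n ℤ.* defect s m₁ y q₁ ℤ.+ e ℤ.+ c ℤ.* c
      ≡⟨ cong (λ z → n ℤ.* n ℤ.* defect s m₁ z q₁ ℤ.+ e ℤ.+ c ℤ.* c) (cong +_ (ℕ.+-suc N b)) ⟩
    n ℤ.* n ℤ.* residual s v b k (suc N) ℤ.+ e ℤ.+ c ℤ.* c ∎
    where
    open ≡-Reasoning
    K = + (N ℕ.+ k)
    n = + N
    m = + rising k N
    m₁ = + rising k (suc N)
    q = numerator (shiftCoefs v) k N
    q₁ = numerator v k (suc N)
    y = + (N ℕ.+ suc b)
    e = ℤ.- (+ 2 ℤ.* c) ℤ.* (K ℤ.* (m ℤ.* y ℤ.+ q))
    m-eq : n ℤ.* m₁ ≡ K ℤ.* m
    m-eq = trans (sym (ℤ.pos-* N (rising k (suc N)))) (trans (cong +_ (rising-shift k N)) (ℤ.pos-* (N ℕ.+ k) (rising k N)))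

-- Nonnegative combinations of expansions

-- (s , b) stands for √((N+b)² + 4s).
Generator : Set
Generator = ℤ × ℕ

coefs : Generator → ℕ → ℤ
coefs (s , b) = coef s b

Combination : Set
Combination = List (ℕ × Generator)

total : Combination → ℕ → ℤ
total []            i = 0ℤ
total ((x , g) ∷ W) i = + x ℤ.* coefs g i ℤ.+ total W i

scale : ℕ → Combination → Combination
scale c = map λ (x , g) → c ℕ.* x , g

shift : Combination → Combination
shift = map λ (x , s , b) → x , s , suc b

shift* : ℕ → Combination → Combination
shift* zero    W = W
shift* (suc B) W = shift (shift* B W)

total-++ : ∀ V W i → total (V ++ W) i ≡ total V i ℤ.+ total W i
total-++ []            W i = sym (ℤ.+-identityˡ (total W i))
total-++ ((x , g) ∷ V) W i = trans (cong (λ z → + x ℤ.* coefs g i ℤ.+ z) (total-++ V W i)) (sym (ℤ.+-assoc (+ x ℤ.* coefs g i) (total V i) (total W i)))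

total-scale : ∀ c W i → total (scale c W) i ≡ + c ℤ.* total W i
total-scale c []            i = sym (ℤ.*-zeroʳ (+ c))
total-scale c ((x , g) ∷ W) i = trans (cong₂ (λ y z → y ℤ.* coefs g i ℤ.+ z) (ℤ.pos-* c x) (total-scale c W i)) (aux (+ c) (+ x) (coefs g i) (total W i))
  where
  aux : ∀ c x v t → c ℤ.* x ℤ.* v ℤ.+ c ℤ.* t ≡ c ℤ.* (x ℤ.* v ℤ.+ t)
  aux = solve-∀

total-shift : ∀ W i → total (shift W) i ≡ shiftCoefs (total W) i
total-shift []                zero    = refl
total-shift []                (suc i) = sym (cong (λ z → 0ℤ ℤ.- z) (ℤ.*-zeroʳ (+ suc i)))
total-shift ((x , s , b) ∷ W) zero    = trans (cong (λ z → + x ℤ.* (coef s b 0 ℤ.- 0ℤ) ℤ.+ z) (total-shift W 0)) (aux (+ x) (coef s b 0) (total W 0))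
  where
  aux : ∀ x v t → x ℤ.* (v ℤ.- 0ℤ) ℤ.+ (t ℤ.- 0ℤ) ≡ x ℤ.* v ℤ.+ t ℤ.- 0ℤ
  aux = solve-∀
total-shift ((x , s , b) ∷ W) (suc i) = trans (cong (λ z → + x ℤ.* shiftCoefs (coef s b) (suc i) ℤ.+ z) (total-shift W (suc i)))
  (aux (+ x) (coef s b (suc i)) (coef s b i) (+ suc i) (total W (suc i)) (total W i))
  where
  aux : ∀ x v u i t r → x ℤ.* (v ℤ.- i ℤ.* u) ℤ.+ (t ℤ.- i ℤ.* r) ≡ x ℤ.* v ℤ.+ t ℤ.- i ℤ.* (x ℤ.* u ℤ.+ r)
  aux = solve-∀

record Leading (m : ℕ) (c : ℤ) (W : Combination) : Set where
  field
    below : ∀ i → i < m → total W i ≡ 0ℤ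
    at    : total W m ≡ c
open Leading

leading-cong : ∀ {m c c′ W} → c ≡ c′ → Leading m c W → Leading m c′ W
leading-cong refl h = h

leading-++ : ∀ {m c d V W} → Leading m c V → Leading m d W → Leading m (c ℤ.+ d) (V ++ W)
leading-++ {V = V} {W} h h′ .below i i<m = trans (total-++ V W i) (cong₂ ℤ._+_ (h .below i i<m) (h′ .below i i<m))
leading-++ {m} {V = V} {W} h h′ .at = trans (total-++ V W m) (cong₂ ℤ._+_ (h .at) (h′ .at))

leading-scale : ∀ {m c W} n → Leading m c W → Leading m (+ n ℤ.* c) (scale n W)
leading-scale {W = W} n h .below i i<m = trans (total-scale n W i) (trans (cong (+ n ℤ.*_) (h .below i i<m)) (ℤ.*-zeroʳ (+ n)))
leading-scale {m} {W = W} n h .at = trans (total-scale n W m) (cong (+ n ℤ.*_) (h .at))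

leading-suc : ∀ {m W} → Leading m 0ℤ W → Leading (suc m) (total W (suc m)) W
leading-suc {m} h .below i i<1+m with ℕ.m<1+n⇒m<n∨m≡n i<1+m
... | inj₁ i<m  = h .below i i<m
... | inj₂ refl = h .at
leading-suc h .at = refl

leading-shift : ∀ {m c W} → Leading m c W → Leading m c (shift W)
leading-shift {W = W} h .below zero    0<m   = trans (total-shift W 0) (cong (ℤ._- 0ℤ) (h .below 0 0<m))
leading-shift {W = W} h .below (suc i) 1+i<m = trans (total-shift W (suc i))
  (trans (cong₂ (λ a b → a ℤ.- + suc i ℤ.* b) (h .below (suc i) 1+i<m) (h .below i (ℕ.<-trans (ℕ.n<1+n i) 1+i<m)))
    (cong (λ z → 0ℤ ℤ.- z) (ℤ.*-zeroʳ (+ suc i))))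
leading-shift {zero}  {c} {W} h .at = trans (total-shift W 0) (trans (ℤ.+-identityʳ (total W 0)) (h .at))
leading-shift {suc m} {c} {W} h .at = trans (total-shift W (suc m)) (trans
  (cong₂ (λ a b → a ℤ.- + suc m ℤ.* b) (h .at) (h .below m (ℕ.n<1+n m))) (aux c (+ suc m)))
  where
  aux : ∀ c m → c ℤ.- m ℤ.* 0ℤ ≡ c
  aux = solve-∀

leading-shift* : ∀ {m c W} B → Leading m c W → Leading m c (shift* B W)
leading-shift* zero    h = h
leading-shift* (suc B) h = leading-shift (leading-shift* B h)

-- Coefficient `suc m` receives only from coefficient `m`, which every translation leaves at `c`;
-- hence the linear dependence on `B`. This is what lets `B` decide a sign in `both-signs`.
total-shift* : ∀ {m c W} B → Leading m c W → total (shift* B W) (suc m) ≡ total W (suc m) ℤ.- + B ℤ.* (+ suc m ℤ.* c)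
total-shift* {m} {c} {W} zero h = aux (total W (suc m)) (+ suc m ℤ.* c)
  where
  aux : ∀ t m → t ≡ t ℤ.- 0ℤ ℤ.* m
  aux = solve-∀
total-shift* {m} {c} {W} (suc B) h = trans (total-shift (shift* B W) (suc m))
  (trans (cong₂ (λ a b → a ℤ.- + suc m ℤ.* b) (total-shift* B h) (leading-shift* B h .at))
    (aux (total W (suc m)) (+ B) (+ suc m) c))
  where
  aux : ∀ t B m c → t ℤ.- B ℤ.* (m ℤ.* c) ℤ.- m ℤ.* c ≡ t ℤ.- (1ℤ ℤ.+ B) ℤ.* (m ℤ.* c)
  aux = solve-∀

positive-shift : ∀ d e → ∃[ p ] d ℤ.+ + (∣ d ∣ ℕ.+ suc e) ≡ + suc p
positive-shift (+ n)    e = n ℕ.+ (n ℕ.+ e) , cong +_ (trans (cong (n ℕ.+_) (ℕ.+-suc n e)) (ℕ.+-suc n (n ℕ.+ e)))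
positive-shift -[1+ n ] e = e , aux (+ suc n) (+ suc e)
  where
  aux : ∀ n e → ℤ.- n ℤ.+ (n ℤ.+ e) ≡ e
  aux = solve-∀

negative-shift : ∀ d e → ∃[ q ] d ℤ.- + (∣ d ∣ ℕ.+ suc e) ≡ -[1+ q ]
negative-shift d e with positive-shift (ℤ.- d) e
... | q , eq = q , trans (aux d (+ (∣ d ∣ ℕ.+ suc e))) (cong ℤ.-_ (trans (cong (λ z → ℤ.- d ℤ.+ + (z ℕ.+ suc e)) (sym (ℤ.∣-i∣≡∣i∣ d))) eq))
  where
  aux : ∀ d e → d ℤ.- e ≡ ℤ.- (ℤ.- d ℤ.+ e)
  aux = solve-∀

both-signs : ∀ m → ∃[ V ] ∃[ W ] ∃[ p ] ∃[ q ] Leading m (+ suc p) V × Leading m -[1+ q ] W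
-- `√(N² + 4)` and `√(N² - 4)` have first coefficients 2 and -2, that is `suc 1` and `-[1+ 1 ]`.
both-signs zero = (1 , 1ℤ , 0) ∷ [] , (1 , -[1+ 0 ] , 0) ∷ [] , 1 , 1 ,
  record { below = λ _ () ; at = refl } , record { below = λ _ () ; at = refl }
both-signs (suc m) with both-signs m
... | V , W , p , q , hV , hW = V₁ ++ shift* B W₁ , W₁ ++ shift* B V₁ , _ , _ ,
    leading-cong pos (leading-suc (leading-cong (ℤ.+-inverseʳ C) (leading-++ hV₁ (leading-shift* B hW₁)))) ,
    leading-cong neg (leading-suc (leading-cong (ℤ.+-inverseˡ C) (leading-++ hW₁ (leading-shift* B hV₁))))
  where
  V₁ = scale (suc q) V
  W₁ = scale (suc p) W
  C = + suc q ℤ.* + suc p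
  hV₁ : Leading m C V₁
  hV₁ = leading-scale (suc q) hV
  hW₁ : Leading m (ℤ.- C) W₁
  hW₁ = leading-cong (aux (+ suc p) (+ suc q)) (leading-scale (suc p) hW)
    where
    aux : ∀ p q → p ℤ.* (ℤ.- q) ≡ ℤ.- (q ℤ.* p)
    aux = solve-∀
  d = total V₁ (suc m) ℤ.+ total W₁ (suc m)
  -- `B(m+1)C` has to exceed `∣ d ∣` to override the unshifted value `d`, and `(m+1)C ≥ 1`. With
  -- `C = suc t` the excess is `suc e`. The same `B` serves both signs.
  B = suc ∣ d ∣
  t = p ℕ.+ q ℕ.* suc p
  e = t ℕ.+ m ℕ.* suc t ℕ.+ ∣ d ∣ ℕ.* (t ℕ.+ m ℕ.* suc t)
  BmC : + B ℤ.* (+ suc m ℤ.* C) ≡ + (∣ d ∣ ℕ.+ suc e)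
  BmC = trans (sym (ℤ.pos-* B (suc m ℕ.* suc t))) (cong +_ (aux ∣ d ∣ m t))
    where
    aux : ∀ d m t → (1 ℕ.+ d) ℕ.* ((1 ℕ.+ m) ℕ.* (1 ℕ.+ t)) ≡ d ℕ.+ (1 ℕ.+ (t ℕ.+ m ℕ.* (1 ℕ.+ t) ℕ.+ d ℕ.* (t ℕ.+ m ℕ.* (1 ℕ.+ t))))
    aux = ℕSolver.solve-∀
  pos : total (V₁ ++ shift* B W₁) (suc m) ≡ + suc (proj₁ (positive-shift d e))
  pos = begin
    total (V₁ ++ shift* B W₁) (suc m)                       ≡⟨ total-++ V₁ (shift* B W₁) (suc m) ⟩
    total V₁ (suc m) ℤ.+ total (shift* B W₁) (suc m)        ≡⟨ cong (λ z → total V₁ (suc m) ℤ.+ z) (total-shift* B hW₁) ⟩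
    total V₁ (suc m) ℤ.+ (total W₁ (suc m) ℤ.- + B ℤ.* (+ suc m ℤ.* ℤ.- C)) ≡⟨ aux (total V₁ (suc m)) (total W₁ (suc m)) (+ B) (+ suc m) C ⟩
    d ℤ.+ + B ℤ.* (+ suc m ℤ.* C)                           ≡⟨ cong (λ z → d ℤ.+ z) BmC ⟩
    d ℤ.+ + (∣ d ∣ ℕ.+ suc e)                               ≡⟨ proj₂ (positive-shift d e) ⟩
    + suc (proj₁ (positive-shift d e))                      ∎
    where
    open ≡-Reasoning
    aux : ∀ a b B m C → a ℤ.+ (b ℤ.- B ℤ.* (m ℤ.* ℤ.- C)) ≡ a ℤ.+ b ℤ.+ B ℤ.* (m ℤ.* C)
    aux = solve-∀
  neg : total (W₁ ++ shift* B V₁) (suc m) ≡ -[1+ proj₁ (negative-shift d e) ]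
  neg = begin
    total (W₁ ++ shift* B V₁) (suc m)                       ≡⟨ total-++ W₁ (shift* B V₁) (suc m) ⟩
    total W₁ (suc m) ℤ.+ total (shift* B V₁) (suc m)        ≡⟨ cong (λ z → total W₁ (suc m) ℤ.+ z) (total-shift* B hV₁) ⟩
    total W₁ (suc m) ℤ.+ (total V₁ (suc m) ℤ.- + B ℤ.* (+ suc m ℤ.* C)) ≡⟨ aux (total V₁ (suc m)) (total W₁ (suc m)) (+ B ℤ.* (+ suc m ℤ.* C)) ⟩
    d ℤ.- + B ℤ.* (+ suc m ℤ.* C)                           ≡⟨ cong (λ z → d ℤ.- z) BmC ⟩
    d ℤ.- + (∣ d ∣ ℕ.+ suc e)                               ≡⟨ proj₂ (negative-shift d e) ⟩
    -[1+ proj₁ (negative-shift d e) ]                       ∎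
    where
    open ≡-Reasoning
    aux : ∀ a b c → b ℤ.+ (a ℤ.- c) ≡ a ℤ.+ b ℤ.- c
    aux = solve-∀

-- Carathéodory's theorem

sum-zero : ∀ {n} (f : Fin n → ℤ) → (∀ j → f j ≡ 0ℤ) → sum f ≡ 0ℤ
sum-zero {n} f h = trans (sum-cong-≗ h) (ℤΣ.sum-replicate-zero n)

sum-punchIn : ∀ {n} j (f : Fin (suc n) → ℤ) → sum f ≡ f j ℤ.+ sum (λ l → f (punchIn j l))
sum-punchIn j f = sum-remove ℤ.+-0-commutativeMonoid {i = j} f

-- Fraction-free elimination of the last coordinate: with a pivot `p = u j k`, the vectors
-- `p · v l - v l k · u j` vanish there, and a dependence `z` among them lifts to weights `p · z`
-- off `j`, still nontrivial as `p ≠ 0`. Without a pivot the last coordinate imposes nothing, and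
-- one vector gets weight 0.
dependence : ∀ k (u : Fin (suc k) → ℕ → ℤ) →
  Σ[ y ∈ (Fin (suc k) → ℤ) ] (∃[ j ] y j ≢ 0ℤ) × (∀ i → i < k → sum (λ j → y j ℤ.* u j i) ≡ 0ℤ)
dependence zero    u = (λ _ → 1ℤ) , (zero , λ ()) , λ _ ()
dependence (suc k) u with Fin.any? (λ j → ¬? (u j k ℤ.≟ 0ℤ))
... | no ¬pivot with dependence k (λ j → u (suc j))
...   | y , (j , yj≢0) , dep = 0ℤ ◂ y , (suc j , yj≢0) , dep′
  where
  dep′ : ∀ i → i < suc k → sum (λ j → (0ℤ ◂ y) j ℤ.* u j i) ≡ 0ℤ
  dep′ i i<1+k with ℕ.m<1+n⇒m<n∨m≡n i<1+k
  ... | inj₁ i<k  = trans (ℤ.+-identityˡ _) (dep i i<k)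
  ... | inj₂ refl = sum-zero (λ j → (0ℤ ◂ y) j ℤ.* u j k) λ j → trans
    (cong ((0ℤ ◂ y) j ℤ.*_) (decidable-stable (u j k ℤ.≟ 0ℤ) λ ≢0 → ¬pivot (j , ≢0))) (ℤ.*-zeroʳ ((0ℤ ◂ y) j))
dependence (suc k) u | yes (j , p≢0) with dependence k (λ l i → u j k ℤ.* u (punchIn j l) i ℤ.- u (punchIn j l) k ℤ.* u j i)
... | z , (l , zl≢0) , dep = y , (punchIn j l , yl≢0) , dep′
  where
  p = u j k
  v : Fin (suc k) → ℕ → ℤ
  v l = u (punchIn j l)
  y₀ = ℤ.- sum (λ l → z l ℤ.* v l k)
  pz : Fin (suc k) → ℤ
  pz l = p ℤ.* z l
  y = insertAt pz j y₀
  yl≢0 : y (punchIn j l) ≢ 0ℤ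
  yl≢0 e with ℤ.i*j≡0⇒i≡0∨j≡0 p (trans (sym (insertAt-punchIn pz j y₀ l)) e)
  ... | inj₁ p≡0  = p≢0 p≡0
  ... | inj₂ zl≡0 = zl≢0 zl≡0
  expand : ∀ i → sum (λ j → y j ℤ.* u j i) ≡ sum (λ l → z l ℤ.* (p ℤ.* v l i ℤ.- v l k ℤ.* u j i))
  expand i = begin
    sum (λ j → y j ℤ.* u j i)
      ≡⟨ sum-punchIn j (λ j → y j ℤ.* u j i) ⟩
    y j ℤ.* u j i ℤ.+ sum (λ l → y (punchIn j l) ℤ.* v l i)
      ≡⟨ cong₂ ℤ._+_ (cong (ℤ._* u j i) (insertAt-lookup pz j y₀))
           (sum-cong-≗ λ l → cong (ℤ._* v l i) (insertAt-punchIn pz j y₀ l)) ⟩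
    y₀ ℤ.* u j i ℤ.+ sum (λ l → p ℤ.* z l ℤ.* v l i)
      ≡⟨ cong (ℤ._+ sum (λ l → p ℤ.* z l ℤ.* v l i)) (trans (aux₁ (sum (λ l → z l ℤ.* v l k)) (u j i)) (ℤΣ.*-distribˡ-sum (ℤ.- u j i) (λ l → z l ℤ.* v l k))) ⟩
    sum (λ l → ℤ.- u j i ℤ.* (z l ℤ.* v l k)) ℤ.+ sum (λ l → p ℤ.* z l ℤ.* v l i)
      ≡⟨ ∑-distrib-+ ℤ.+-0-commutativeMonoid (λ l → ℤ.- u j i ℤ.* (z l ℤ.* v l k)) (λ l → p ℤ.* z l ℤ.* v l i) ⟨
    sum (λ l → ℤ.- u j i ℤ.* (z l ℤ.* v l k) ℤ.+ p ℤ.* z l ℤ.* v l i)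
      ≡⟨ sum-cong-≗ (λ l → aux₂ (u j i) (z l) (v l k) p (v l i)) ⟩
    sum (λ l → z l ℤ.* (p ℤ.* v l i ℤ.- v l k ℤ.* u j i)) ∎
    where
    open ≡-Reasoning
    aux₁ : ∀ s u → ℤ.- s ℤ.* u ≡ ℤ.- u ℤ.* s
    aux₁ = solve-∀
    aux₂ : ∀ u z w p v → ℤ.- u ℤ.* (z ℤ.* w) ℤ.+ p ℤ.* z ℤ.* v ≡ z ℤ.* (p ℤ.* v ℤ.- w ℤ.* u)
    aux₂ = solve-∀
  dep′ : ∀ i → i < suc k → sum (λ j → y j ℤ.* u j i) ≡ 0ℤ
  dep′ i i<1+k with ℕ.m<1+n⇒m<n∨m≡n i<1+k
  ... | inj₁ i<k  = trans (expand i) (dep i i<k)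
  ... | inj₂ refl = trans (expand k) (sum-zero _ λ l → aux (z l) p (v l k))
    where
    aux : ∀ z p v → z ℤ.* (p ℤ.* v ℤ.- v ℤ.* p) ≡ 0ℤ
    aux = solve-∀

positive-dependence : ∀ k (u : Fin (suc k) → ℕ → ℤ) →
  Σ[ y ∈ (Fin (suc k) → ℤ) ] (∃[ j ] ∃[ Y ] y j ≡ + suc Y) × (∀ i → i < k → sum (λ j → y j ℤ.* u j i) ≡ 0ℤ)
positive-dependence k u with dependence k u
... | y , (j , yj≢0) , dep with y j in eq
...   | + zero   = contradiction refl yj≢0
...   | + suc Y  = y , (j , Y , eq) , dep
...   | -[1+ Y ] = (λ j → ℤ.- y j) , (j , Y , cong ℤ.-_ eq) , λ i i<k → begin
    sum (λ j → ℤ.- y j ℤ.* u j i)             ≡⟨ sum-cong-≗ (λ j → aux (y j) (u j i)) ⟩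
    sum (λ j → -[1+ 0 ] ℤ.* (y j ℤ.* u j i))  ≡⟨ ℤΣ.*-distribˡ-sum -[1+ 0 ] (λ j → y j ℤ.* u j i) ⟨
    -[1+ 0 ] ℤ.* sum (λ j → y j ℤ.* u j i)    ≡⟨ cong (-[1+ 0 ] ℤ.*_) (dep i i<k) ⟩
    0ℤ                                        ∎
    where
    open ≡-Reasoning
    aux : ∀ y u → ℤ.- y ℤ.* u ≡ -[1+ 0 ] ℤ.* (y ℤ.* u)
    aux = solve-∀

-- The ratio test of linear programming, cross-multiplied: `j` minimises `x / t` where `t` is
-- positive, so it is the first weight to reach 0 when growing multiples of `t` are subtracted from
-- `x`.
min-ratio : ∀ {n} (x t : Fin n → ℕ) → (∀ l → t l ≡ 0) ⊎ ∃[ j ] (∃[ Y ] t j ≡ suc Y) × (∀ l → x j ℕ.* t l ≤ t j ℕ.* x l)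
min-ratio {zero}  x t = inj₁ λ ()
min-ratio {suc n} x t with t zero in eq | min-ratio (λ j → x (suc j)) (λ j → t (suc j))
... | zero | inj₁ t≡0 = inj₁ λ { zero → eq ; (suc l) → t≡0 l }
... | zero | inj₂ (j , pos , min) = inj₂ (suc j , pos , λ
  { zero → subst (λ z → x (suc j) ℕ.* z ≤ t (suc j) ℕ.* x zero) (sym eq) (ℕ.≤-trans (ℕ.≤-reflexive (ℕ.*-zeroʳ (x (suc j)))) ℕ.z≤n) ; (suc l) → min l })
... | suc Y | inj₁ t≡0 = inj₂ (zero , (Y , eq) , λ
  { zero → ℕ.≤-reflexive (ℕ.*-comm (x zero) (t zero))
  ; (suc l) → subst (λ z → x zero ℕ.* z ≤ t zero ℕ.* x (suc l)) (sym (t≡0 l)) (ℕ.≤-trans (ℕ.≤-reflexive (ℕ.*-zeroʳ (x zero))) ℕ.z≤n) })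
... | suc Y | inj₂ (j , (Z , tj) , min) with x (suc j) ℕ.* t zero ℕ.≤? t (suc j) ℕ.* x zero
...   | yes h = inj₂ (suc j , (Z , tj) , λ { zero → h ; (suc l) → min l })
...   | no ¬h = inj₂ (zero , (Y , eq) , λ { zero → ℕ.≤-reflexive (ℕ.*-comm (x zero) (t zero)) ; (suc l) → bnd l })
  where
  bnd : ∀ l → x zero ℕ.* t (suc l) ≤ t zero ℕ.* x (suc l)
  bnd l = ℕ.*-cancelˡ-≤ (t (suc j)) {{subst ℕ.NonZero (sym tj) _}} (begin
    t (suc j) ℕ.* (x zero ℕ.* t (suc l))     ≡⟨ ℕ.*-assoc (t (suc j)) (x zero) (t (suc l)) ⟨
    t (suc j) ℕ.* x zero ℕ.* t (suc l)       ≤⟨ ℕ.*-monoˡ-≤ (t (suc l)) (ℕ.<⇒≤ (ℕ.≰⇒> ¬h)) ⟩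
    x (suc j) ℕ.* t zero ℕ.* t (suc l)       ≡⟨ aux (x (suc j)) (t zero) (t (suc l)) ⟩
    t zero ℕ.* (x (suc j) ℕ.* t (suc l))     ≤⟨ ℕ.*-monoʳ-≤ (t zero) (min l) ⟩
    t zero ℕ.* (t (suc j) ℕ.* x (suc l))     ≡⟨ aux′ (t zero) (t (suc j)) (x (suc l)) ⟩
    t (suc j) ℕ.* (t zero ℕ.* x (suc l))     ∎)
    where
    open ℕ.≤-Reasoning
    aux : ∀ a b c → a ℕ.* b ℕ.* c ≡ b ℕ.* (a ℕ.* c)
    aux = ℕSolver.solve-∀
    aux′ : ∀ a b c → a ℕ.* (b ℕ.* c) ≡ b ℕ.* (a ℕ.* c)
    aux′ = ℕSolver.solve-∀

posPart : ℤ → ℕ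
posPart (+ n)    = n
posPart -[1+ n ] = 0

i≤posPart : ∀ i → i ℤ.≤ + posPart i
i≤posPart (+ n)    = ℤ.≤-refl
i≤posPart -[1+ n ] = ℤ.-≤+

posPart-positive : ∀ i {Y} → posPart i ≡ suc Y → i ≡ + suc Y
posPart-positive (+ n) e = cong +_ e

-- Moving from `x` against a dependence `y` keeps the sum; stopping at the minimal ratio kills
-- weight `j` and leaves the others nonnegative. Cleared of the denominator `y j = suc Y`, the new
-- weights are `suc Y · x l - x j · y l`.
reduce : ∀ k (u : Fin (suc k) → ℕ → ℤ) (x : Fin (suc k) → ℕ) →
  Σ[ j ∈ Fin (suc k) ] Σ[ x′ ∈ (Fin k → ℕ) ] ∃[ Y ] (∀ i → i < k →
    sum (λ l → + x′ l ℤ.* u (punchIn j l) i) ≡ + suc Y ℤ.* sum (λ l → + x l ℤ.* u l i))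
reduce k u x with positive-dependence k u
... | y , (j₀ , Y₀ , yj₀) , dep with min-ratio x (λ l → posPart (y l))
...   | inj₁ ≡0 = contradiction (trans (sym (cong posPart yj₀)) (≡0 j₀)) λ ()
...   | inj₂ (j , (Y , tj) , min) = j , (λ l → x′ (punchIn j l)) , Y , λ i i<k → begin
    sum (λ l → + x′ (punchIn j l) ℤ.* u (punchIn j l) i)
      ≡⟨ ℤ.+-identityˡ _ ⟨
    0ℤ ℤ.+ sum (λ l → + x′ (punchIn j l) ℤ.* u (punchIn j l) i)
      ≡⟨ cong (λ z → z ℤ.* u j i ℤ.+ sum (λ l → + x′ (punchIn j l) ℤ.* u (punchIn j l) i)) (sym x′j≡0) ⟩
    + x′ j ℤ.* u j i ℤ.+ sum (λ l → + x′ (punchIn j l) ℤ.* u (punchIn j l) i)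
      ≡⟨ sum-punchIn j (λ l → + x′ l ℤ.* u l i) ⟨
    sum (λ l → + x′ l ℤ.* u l i)
      ≡⟨ sum-cong-≗ (λ l → trans (cong (ℤ._* u l i) (x′-eq l)) (aux (+ suc Y) (+ x l) (+ x j) (y l) (u l i))) ⟩
    sum (λ l → + suc Y ℤ.* (+ x l ℤ.* u l i) ℤ.+ ℤ.- (+ x j) ℤ.* (y l ℤ.* u l i))
      ≡⟨ ∑-distrib-+ ℤ.+-0-commutativeMonoid (λ l → + suc Y ℤ.* (+ x l ℤ.* u l i)) (λ l → ℤ.- (+ x j) ℤ.* (y l ℤ.* u l i)) ⟩
    sum (λ l → + suc Y ℤ.* (+ x l ℤ.* u l i)) ℤ.+ sum (λ l → ℤ.- (+ x j) ℤ.* (y l ℤ.* u l i))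
      ≡⟨ cong₂ ℤ._+_ (sym (ℤΣ.*-distribˡ-sum (+ suc Y) (λ l → + x l ℤ.* u l i)))
           (trans (sym (ℤΣ.*-distribˡ-sum (ℤ.- (+ x j)) (λ l → y l ℤ.* u l i)))
             (trans (cong (ℤ.- (+ x j) ℤ.*_) (dep i i<k)) (ℤ.*-zeroʳ (ℤ.- (+ x j))))) ⟩
    + suc Y ℤ.* sum (λ l → + x l ℤ.* u l i) ℤ.+ 0ℤ
      ≡⟨ ℤ.+-identityʳ _ ⟩
    + suc Y ℤ.* sum (λ l → + x l ℤ.* u l i) ∎
    where
    open ≡-Reasoning
    aux : ∀ Y x X y u → (Y ℤ.* x ℤ.- X ℤ.* y) ℤ.* u ≡ Y ℤ.* (x ℤ.* u) ℤ.+ ℤ.- X ℤ.* (y ℤ.* u)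
    aux = solve-∀
    x′ : Fin (suc k) → ℕ
    x′ l = ∣ + suc Y ℤ.* + x l ℤ.- + x j ℤ.* y l ∣
    x′-eq : ∀ l → + x′ l ≡ + suc Y ℤ.* + x l ℤ.- + x j ℤ.* y l
    x′-eq l = ℤ.0≤i⇒+∣i∣≡i (ℤ.i≤j⇒0≤j-i (ℤ.≤-trans
      (ℤ.*-monoˡ-≤-nonNeg (+ x j) (i≤posPart (y l)))
      (subst₂ ℤ._≤_ (ℤ.pos-* (x j) (posPart (y l))) (trans (cong (λ z → + (z ℕ.* x l)) tj) (ℤ.pos-* (suc Y) (x l))) (ℤ.+≤+ (min l)))))
    x′j≡0 : + x′ j ≡ 0ℤ
    x′j≡0 = trans (x′-eq j) (trans (cong (λ z → + suc Y ℤ.* + x j ℤ.- + x j ℤ.* z) (posPart-positive (y j) tj)) (aux′ (+ suc Y) (+ x j)))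
      where
      aux′ : ∀ Y x → Y ℤ.* x ℤ.- x ℤ.* Y ≡ 0ℤ
      aux′ = solve-∀

-- Induction on `W` keeps `k` generators throughout: one more makes `k + 1`, and `reduce` drops one.
-- Denominators are cleared at each step and accumulate in `suc Y`. Padding with weight 0 starts the
-- induction, and zero weights may survive to the end.
carathéodory : ∀ k W → Σ[ g ∈ (Fin k → Generator) ] Σ[ x ∈ (Fin k → ℕ) ] ∃[ Y ] (∀ i → i < k →
  sum {k} (λ j → + x j ℤ.* coefs (g j) i) ≡ + suc Y ℤ.* total W i)
carathéodory k [] = (λ _ → 0ℤ , 0) , (λ _ → 0) , 0 , λ i _ → sum-zero {k} _ λ j → refl
carathéodory k ((x₀ , g₀) ∷ W) with carathéodory k W
... | g , x , Y , eq with reduce k (λ j → coefs ((g₀ ◂ g) j)) ((suc Y ℕ.* x₀) ◂ x)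
...   | j , x′ , Z , eq′ = (λ l → (g₀ ◂ g) (punchIn j l)) , x′ , Y ℕ.+ Z ℕ.* suc Y , λ i i<k → trans (eq′ i i<k)
    (trans (cong₂ (λ a b → + suc Z ℤ.* (a ℤ.* coefs g₀ i ℤ.+ b)) (ℤ.pos-* (suc Y) x₀) (eq i i<k))
      (trans (aux (+ suc Z) (+ suc Y) (+ x₀) (coefs g₀ i) (total W i))
        (cong (ℤ._* (+ x₀ ℤ.* coefs g₀ i ℤ.+ total W i)) (sym (ℤ.pos-* (suc Z) (suc Y))))))
    where
    aux : ∀ Z Y x c t → Z ℤ.* (Y ℤ.* x ℤ.* c ℤ.+ Y ℤ.* t) ≡ Z ℤ.* Y ℤ.* (x ℤ.* c ℤ.+ t)
    aux = solve-∀

-- Sums of real square roots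

m*m≤n*n⇒m≤n : ∀ {m n} → m ℕ.* m ≤ n ℕ.* n → m ≤ n
m*m≤n*n⇒m≤n {m} {n} h = ℕ.≮⇒≥ λ n<m → ℕ.<⇒≱ (ℕ.*-mono-< n<m n<m) h

-- √a lies within d/(mN) of A/m.
record Near (m N a A d : ℕ) : Set where
  field
    upper : N ℕ.* (a ℕ.* (m ℕ.* m)) ≤ N ℕ.* (A ℕ.* A) ℕ.+ d ℕ.* A
    lower : N ℕ.* (A ℕ.* A) ≤ N ℕ.* (a ℕ.* (m ℕ.* m)) ℕ.+ d ℕ.* A
open Near

-- Multiplied by `N`, `upper` gives `N²am² ≤ (AN)² + dAN ≤ (AN + d)²`, hence `mN√a ≤ AN + d`.
approx√-≤-near : ∀ {m N a A d} → Near m N a A d → ∀ n →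
  approx√ a 1 n ℕ.* (m ℕ.* N) ≤ (A ℕ.* N ℕ.+ d) ℕ.* n
approx√-≤-near {m} {N} {a} {A} {d} near n = m*m≤n*n⇒m≤n (begin
  s ℕ.* (m ℕ.* N) ℕ.* (s ℕ.* (m ℕ.* N))             ≡⟨ aux₁ s m N ⟩
  s ℕ.* s ℕ.* 1 ℕ.* (m ℕ.* m ℕ.* N ℕ.* N)           ≤⟨ ℕ.*-monoˡ-≤ (m ℕ.* m ℕ.* N ℕ.* N) (approx√-lower a 1 n) ⟩
  a ℕ.* (n ℕ.* n) ℕ.* (m ℕ.* m ℕ.* N ℕ.* N)         ≡⟨ aux₂ a n m N ⟩
  N ℕ.* (a ℕ.* (m ℕ.* m)) ℕ.* (N ℕ.* (n ℕ.* n))     ≤⟨ ℕ.*-monoˡ-≤ (N ℕ.* (n ℕ.* n)) (near .upper) ⟩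
  (N ℕ.* (A ℕ.* A) ℕ.+ d ℕ.* A) ℕ.* (N ℕ.* (n ℕ.* n))                          ≤⟨ ℕ.m≤m+n _ (d ℕ.* A ℕ.* N ℕ.* (n ℕ.* n) ℕ.+ d ℕ.* d ℕ.* (n ℕ.* n)) ⟩
  (N ℕ.* (A ℕ.* A) ℕ.+ d ℕ.* A) ℕ.* (N ℕ.* (n ℕ.* n)) ℕ.+ (d ℕ.* A ℕ.* N ℕ.* (n ℕ.* n) ℕ.+ d ℕ.* d ℕ.* (n ℕ.* n)) ≡⟨ aux₃ A N d n ⟩
  (A ℕ.* N ℕ.+ d) ℕ.* n ℕ.* ((A ℕ.* N ℕ.+ d) ℕ.* n) ∎)
  where
  open ℕ.≤-Reasoning
  s = approx√ a 1 n
  aux₁ : ∀ s m N → s ℕ.* (m ℕ.* N) ℕ.* (s ℕ.* (m ℕ.* N)) ≡ s ℕ.* s ℕ.* 1 ℕ.* (m ℕ.* m ℕ.* N ℕ.* N)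
  aux₁ = ℕSolver.solve-∀
  aux₂ : ∀ a n m N → a ℕ.* (n ℕ.* n) ℕ.* (m ℕ.* m ℕ.* N ℕ.* N) ≡ N ℕ.* (a ℕ.* (m ℕ.* m)) ℕ.* (N ℕ.* (n ℕ.* n))
  aux₂ = ℕSolver.solve-∀
  aux₃ : ∀ A N d n → (N ℕ.* (A ℕ.* A) ℕ.+ d ℕ.* A) ℕ.* (N ℕ.* (n ℕ.* n)) ℕ.+ (d ℕ.* A ℕ.* N ℕ.* (n ℕ.* n) ℕ.+ d ℕ.* d ℕ.* (n ℕ.* n)) ≡ (A ℕ.* N ℕ.+ d) ℕ.* n ℕ.* ((A ℕ.* N ℕ.+ d) ℕ.* n)
  aux₃ = ℕSolver.solve-∀

-- For `t = AN - d ≥ 0`, `t² ≤ t · AN = (AN)² - dAN`, and `lower` bounds this by `N²am²`; so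
-- `AN - d ≤ mN√a`. The `suc` pays for the floor in `approx√`.
near-≤-approx√ : ∀ {m N a A d} → Near m N a A d → ∀ n →
  A ℕ.* N ℕ.* n ≤ suc (approx√ a 1 n) ℕ.* (m ℕ.* N) ℕ.+ d ℕ.* n
near-≤-approx√ {m} {N} {a} {A} {d} near n with ℕ.≤-total (A ℕ.* N) d
... | inj₁ AN≤d = ℕ.≤-trans (ℕ.*-monoˡ-≤ n AN≤d) (ℕ.m≤n+m (d ℕ.* n) _)
... | inj₂ d≤AN with ℕ.m≤n⇒∃[o]m+o≡n d≤AN
...   | t , d+t≡AN = begin
  A ℕ.* N ℕ.* n                      ≡⟨ cong (ℕ._* n) d+t≡AN ⟨
  (d ℕ.+ t) ℕ.* n                    ≡⟨ trans (ℕ.*-distribʳ-+ n d t) (ℕ.+-comm (d ℕ.* n) (t ℕ.* n)) ⟩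
  t ℕ.* n ℕ.+ d ℕ.* n                ≤⟨ ℕ.+-monoˡ-≤ (d ℕ.* n) (m*m≤n*n⇒m≤n tn²≤) ⟩
  suc s ℕ.* (m ℕ.* N) ℕ.+ d ℕ.* n    ∎
  where
  open ℕ.≤-Reasoning
  s = approx√ a 1 n
  aux₀ : ∀ A N t d → A ℕ.* N ℕ.* t ℕ.+ d ℕ.* (A ℕ.* N) ≡ A ℕ.* N ℕ.* (d ℕ.+ t)
  aux₀ = ℕSolver.solve-∀
  aux₁ : ∀ A N → A ℕ.* N ℕ.* (A ℕ.* N) ≡ N ℕ.* (A ℕ.* A) ℕ.* N
  aux₁ = ℕSolver.solve-∀
  aux₂ : ∀ A N a m d → (N ℕ.* (a ℕ.* (m ℕ.* m)) ℕ.+ d ℕ.* A) ℕ.* N ≡ N ℕ.* N ℕ.* (a ℕ.* (m ℕ.* m)) ℕ.+ d ℕ.* (A ℕ.* N)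
  aux₂ = ℕSolver.solve-∀
  tt≤ : t ℕ.* t ≤ N ℕ.* N ℕ.* (a ℕ.* (m ℕ.* m))
  tt≤ = ℕ.+-cancelʳ-≤ (d ℕ.* (A ℕ.* N)) _ _ (begin
    t ℕ.* t ℕ.+ d ℕ.* (A ℕ.* N)               ≤⟨ ℕ.+-monoˡ-≤ _ (ℕ.*-monoˡ-≤ t (subst (t ≤_) d+t≡AN (ℕ.m≤n+m t d))) ⟩
    A ℕ.* N ℕ.* t ℕ.+ d ℕ.* (A ℕ.* N)         ≡⟨ aux₀ A N t d ⟩
    A ℕ.* N ℕ.* (d ℕ.+ t)                     ≡⟨ cong (A ℕ.* N ℕ.*_) d+t≡AN ⟩
    A ℕ.* N ℕ.* (A ℕ.* N)                     ≡⟨ aux₁ A N ⟩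
    N ℕ.* (A ℕ.* A) ℕ.* N                     ≤⟨ ℕ.*-monoˡ-≤ N (near .lower) ⟩
    (N ℕ.* (a ℕ.* (m ℕ.* m)) ℕ.+ d ℕ.* A) ℕ.* N ≡⟨ aux₂ A N a m d ⟩
    N ℕ.* N ℕ.* (a ℕ.* (m ℕ.* m)) ℕ.+ d ℕ.* (A ℕ.* N) ∎)
  aux₃ : ∀ t n → t ℕ.* n ℕ.* (t ℕ.* n) ≡ t ℕ.* t ℕ.* (n ℕ.* n)
  aux₃ = ℕSolver.solve-∀
  aux₄ : ∀ N a m n → N ℕ.* N ℕ.* (a ℕ.* (m ℕ.* m)) ℕ.* (n ℕ.* n) ≡ a ℕ.* (n ℕ.* n) ℕ.* (m ℕ.* N ℕ.* (m ℕ.* N))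
  aux₄ = ℕSolver.solve-∀
  aux₅ : ∀ s x → s ℕ.* s ℕ.* 1 ℕ.* (x ℕ.* x) ≡ s ℕ.* x ℕ.* (s ℕ.* x)
  aux₅ = ℕSolver.solve-∀
  tn²≤ : t ℕ.* n ℕ.* (t ℕ.* n) ≤ suc s ℕ.* (m ℕ.* N) ℕ.* (suc s ℕ.* (m ℕ.* N))
  tn²≤ = begin
    t ℕ.* n ℕ.* (t ℕ.* n)                              ≡⟨ aux₃ t n ⟩
    t ℕ.* t ℕ.* (n ℕ.* n)                              ≤⟨ ℕ.*-monoˡ-≤ (n ℕ.* n) tt≤ ⟩
    N ℕ.* N ℕ.* (a ℕ.* (m ℕ.* m)) ℕ.* (n ℕ.* n)        ≡⟨ aux₄ N a m n ⟩
    a ℕ.* (n ℕ.* n) ℕ.* (m ℕ.* N ℕ.* (m ℕ.* N))        ≤⟨ ℕ.*-monoˡ-≤ (m ℕ.* N ℕ.* (m ℕ.* N)) (ℕ.<⇒≤ (approx√-upper a 1 n)) ⟩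
    suc s ℕ.* suc s ℕ.* 1 ℕ.* (m ℕ.* N ℕ.* (m ℕ.* N))  ≡⟨ aux₅ (suc s) (m ℕ.* N) ⟩
    suc s ℕ.* (m ℕ.* N) ℕ.* (suc s ℕ.* (m ℕ.* N))      ∎

/-+ : ∀ x y D .{{_ : NonZero D}} → + (x ℕ.+ y) / D ≃ + x / D ℚ.+ + y / D
/-+ x y (suc D) = *≡* (aux (+ x) (+ y) (+ suc D))
  where
  aux : ∀ x y d → (x ℤ.+ y) ℤ.* (d ℤ.* d) ≡ (x ℤ.* d ℤ.+ y ℤ.* d) ℤ.* d
  aux = solve-∀

/-* : ∀ c x D .{{_ : NonZero D}} → + (c ℕ.* x) / D ≃ + c / 1 ℚ.* (+ x / D)
/-* c x (suc D) = *≡* (cong₂ ℤ._*_ (ℤ.pos-* c x) (cong +_ (ℕ.*-identityˡ (suc D))))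

cross⇒< : ∀ s t m n .{{_ : NonZero m}} .{{_ : NonZero n}} →
          s ℕ.* n < t ℕ.* m → + s / m ℚ.< + t / n
cross⇒< s t (suc m) (suc n) h =
  *<* (subst₂ ℤ._<_ (ℤ.pos-* s (suc n)) (ℤ.pos-* t (suc m)) (ℤ.+<+ h))

cross⇒≃ : ∀ s t m n .{{_ : NonZero m}} .{{_ : NonZero n}} →
          s ℕ.* n ≡ t ℕ.* m → + s / m ≃ + t / n
cross⇒≃ s t m n h = ℚ.≤-antisym (cross⇒≤ s t m n (ℕ.≤-reflexive h)) (cross⇒≤ t s n m (ℕ.≤-reflexive (sym h)))

cross⇒≤+ : ∀ x t d n D .{{_ : NonZero n}} .{{_ : NonZero D}} →
           x ℕ.* n ≤ t ℕ.* D ℕ.+ d ℕ.* n → + x / D ℚ.≤ + t / n ℚ.+ + d / D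
cross⇒≤+ x t d (suc n) (suc D) h = *≤* (begin
  + x ℤ.* + (suc n ℕ.* suc D)                                             ≡⟨ ℤ.pos-* x (suc n ℕ.* suc D) ⟨
  + (x ℕ.* (suc n ℕ.* suc D))                                             ≤⟨ ℤ.+≤+ h′ ⟩
  + ((t ℕ.* suc D ℕ.+ d ℕ.* suc n) ℕ.* suc D)                             ≡⟨ ℤ.pos-* (t ℕ.* suc D ℕ.+ d ℕ.* suc n) (suc D) ⟩
  + (t ℕ.* suc D ℕ.+ d ℕ.* suc n) ℤ.* + suc D                             ≡⟨ cong (ℤ._* + suc D) (trans (ℤ.pos-+ (t ℕ.* suc D) (d ℕ.* suc n)) (cong₂ ℤ._+_ (ℤ.pos-* t (suc D)) (ℤ.pos-* d (suc n)))) ⟩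
  (+ t ℤ.* + suc D ℤ.+ + d ℤ.* + suc n) ℤ.* + suc D                       ∎)
  where
  h′ : x ℕ.* (suc n ℕ.* suc D) ≤ (t ℕ.* suc D ℕ.+ d ℕ.* suc n) ℕ.* suc D
  h′ = subst (_≤ (t ℕ.* suc D ℕ.+ d ℕ.* suc n) ℕ.* suc D) (ℕ.*-assoc x (suc n) (suc D)) (ℕ.*-monoˡ-≤ (suc D) h)
  open ℤ.≤-Reasoning

0≤x/n : ∀ x n .{{_ : NonZero n}} → 0ℚᵘ ℚ.≤ + x / n
0≤x/n x (suc n) = ℚ.nonNegative⁻¹ (+ x / suc n)

∑√ : ∀ {k} → (Fin k → ℕ) → ℝ
∑√ a = ∑ (λ j → √ (+ a j / 1))

module _ (m N : ℕ) .{{_ : NonZero (m ℕ.* N)}} where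

  private D = m ℕ.* N

  ∑√-upper : ∀ {k} (a A d : Fin k → ℕ) → (∀ j → Near m N (a j) (A j) (d j)) → ∀ n .{{_ : NonZero n}} →
    seq (∑√ a) n ℚ.≤ + (ℕΣ.sum A ℕ.* N ℕ.+ ℕΣ.sum d) / D
  ∑√-upper {zero}  a A d near n = 0≤x/n 0 D
  ∑√-upper {suc k} a A d near n = begin
    + approx√ (a zero) 1 (2 ℕ.* n) / (2 ℕ.* n) ℚ.+ seq (∑√ (λ j → a (suc j))) (2 ℕ.* n)
      ≤⟨ ℚ.+-mono-≤ (cross⇒≤ (approx√ (a zero) 1 (2 ℕ.* n)) x (2 ℕ.* n) D (approx√-≤-near (near zero) (2 ℕ.* n)))
           (∑√-upper (λ j → a (suc j)) (λ j → A (suc j)) (λ j → d (suc j)) (λ j → near (suc j)) (2 ℕ.* n)) ⟩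
    + x / D ℚ.+ + y / D     ≃⟨ /-+ x y D ⟨
    + (x ℕ.+ y) / D         ≡⟨ cong (λ z → + z / D) (aux (A zero) N (d zero) (ℕΣ.sum (λ j → A (suc j))) (ℕΣ.sum (λ j → d (suc j)))) ⟩
    + (ℕΣ.sum A ℕ.* N ℕ.+ ℕΣ.sum d) / D ∎
    where
    open ℚ.≤-Reasoning
    instance _ = ℕ.m*n≢0 2 n
    x = A zero ℕ.* N ℕ.+ d zero
    y = ℕΣ.sum (λ j → A (suc j)) ℕ.* N ℕ.+ ℕΣ.sum (λ j → d (suc j))
    aux : ∀ A N d B e → A ℕ.* N ℕ.+ d ℕ.+ (B ℕ.* N ℕ.+ e) ≡ (A ℕ.+ B) ℕ.* N ℕ.+ (d ℕ.+ e)
    aux = ℕSolver.solve-∀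

  -- Head and tail are evaluated at `2n`, so their rounding losses of `1/(2n)` each add up to `1/n`
  -- whatever `k` is. `∑√-upper` has no such loss because `approx√` rounds down.
  ∑√-lower : ∀ {k} (a A d : Fin k → ℕ) → (∀ j → Near m N (a j) (A j) (d j)) → ∀ n .{{_ : NonZero n}} →
    + (ℕΣ.sum A ℕ.* N) / D ℚ.≤ seq (∑√ a) n ℚ.+ (+ ℕΣ.sum d / D ℚ.+ + 1 / n)
  ∑√-lower {zero}  a A d near n = ℚ.≤-trans (cross⇒≤ 0 0 D 1 ℕ.z≤n)
    (ℚ.≤-trans (ℚ.+-mono-≤ (0≤x/n 0 D) (0≤1/n n)) (ℚ.≤-reflexive (ℚ.≃-sym (ℚ.+-identityˡ (+ 0 / D ℚ.+ + 1 / n)))))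
  ∑√-lower {suc k} a A d near n = begin
    + (ℕΣ.sum A ℕ.* N) / D                          ≡⟨ cong (λ z → + z / D) (ℕ.*-distribʳ-+ N (A zero) ΣA) ⟩
    + (A zero ℕ.* N ℕ.+ ΣA ℕ.* N) / D               ≃⟨ /-+ (A zero ℕ.* N) (ΣA ℕ.* N) D ⟩
    + (A zero ℕ.* N) / D ℚ.+ + (ΣA ℕ.* N) / D
      ≤⟨ ℚ.+-mono-≤ (ℚ.≤-trans (cross⇒≤+ (A zero ℕ.* N) (suc s) (d zero) (2 ℕ.* n) D (near-≤-approx√ (near zero) (2 ℕ.* n)))
           (ℚ.≤-reflexive (ℚ.+-congˡ (+ d zero / D) (suc/ s (2 ℕ.* n)))))
           (∑√-lower (λ j → a (suc j)) (λ j → A (suc j)) (λ j → d (suc j)) (λ j → near (suc j)) (2 ℕ.* n)) ⟩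
    (+ s / (2 ℕ.* n) ℚ.+ h ℚ.+ + d zero / D) ℚ.+ (S′ ℚ.+ (+ Σd / D ℚ.+ h))
      ≃⟨ aux (+ s / (2 ℕ.* n)) h (+ d zero / D) S′ (+ Σd / D) ⟩
    + s / (2 ℕ.* n) ℚ.+ S′ ℚ.+ (+ d zero / D ℚ.+ + Σd / D ℚ.+ (h ℚ.+ h))
      ≃⟨ ℚ.+-congʳ (+ s / (2 ℕ.* n) ℚ.+ S′) (ℚ.+-cong (ℚ.≃-sym (/-+ (d zero) Σd D)) (1/2n+1/2n n)) ⟩
    + s / (2 ℕ.* n) ℚ.+ S′ ℚ.+ (+ ℕΣ.sum d / D ℚ.+ + 1 / n) ∎
    where
    open ℚ.≤-Reasoning
    open ℚSolver.+-*-Solver using (solve; _:=_; _:+_)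
    instance _ = ℕ.m*n≢0 2 n
    s = approx√ (a zero) 1 (2 ℕ.* n)
    h = + 1 / (2 ℕ.* n)
    S′ = seq (∑√ (λ j → a (suc j))) (2 ℕ.* n)
    ΣA = ℕΣ.sum (λ j → A (suc j))
    Σd = ℕΣ.sum (λ j → d (suc j))
    aux : ∀ s h d t e → (s ℚ.+ h ℚ.+ d) ℚ.+ (t ℚ.+ (e ℚ.+ h)) ≃ s ℚ.+ t ℚ.+ (d ℚ.+ e ℚ.+ (h ℚ.+ h))
    aux = solve 5 (λ s h d t e → (s :+ h :+ d) :+ (t :+ (e :+ h)) := s :+ t :+ (d :+ e :+ (h :+ h))) ℚ.≃-refl

+-cancelʳ-≤ : ∀ {p q} r → p ℚ.+ r ℚ.≤ q ℚ.+ r → p ℚ.≤ q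
+-cancelʳ-≤ {p} {q} r h = begin
  p               ≃⟨ cancel p r ⟨
  p ℚ.+ r ℚ.- r   ≤⟨ ℚ.+-monoˡ-≤ (ℚ.- r) h ⟩
  q ℚ.+ r ℚ.- r   ≃⟨ cancel q r ⟩
  q               ∎
  where
  open ℚ.≤-Reasoning
  open ℚSolver.+-*-Solver using (solve; _:=_; _:+_; _:-_)
  cancel : ∀ p r → p ℚ.+ r ℚ.- r ≃ p
  cancel = solve 2 (λ p r → p :+ r :- r := p) ℚ.≃-refl

p+q≤r⇒p≤r-q : ∀ {p q r} → p ℚ.+ q ℚ.≤ r → p ℚ.≤ r ℚ.- q
p+q≤r⇒p≤r-q {p} {q} {r} h = +-cancelʳ-≤ q (ℚ.≤-trans h (ℚ.≤-reflexive (split r q)))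
  where
  open ℚSolver.+-*-Solver using (solve; _:=_; _:+_; _:-_)
  split : ∀ r q → r ≃ r ℚ.- q ℚ.+ q
  split = solve 2 (λ r q → r := r :- q :+ q) ℚ.≃-refl

-- Bounds for the distance to the nearest integer

ofℕ : ℕ → ℝ
ofℕ C .seq n = + C / 1
ofℕ C .reg m n = close h h
  where
  0≤ : 0ℚᵘ ℚ.≤ + 1 / m ℚ.+ + 1 / n
  0≤ = ℚ.+-mono-≤ (0≤1/n m) (0≤1/n n)
  h : + C / 1 ℚ.≤ + C / 1 ℚ.+ (+ 1 / m ℚ.+ + 1 / n)
  h = ℚ.≤-trans (ℚ.≤-reflexive (ℚ.≃-sym (ℚ.+-identityʳ (+ C / 1)))) (ℚ.+-monoʳ-≤ (+ C / 1) 0≤)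

-- At the first approximation `_<ℝ_` asks for a gap of more than `2/1`.
0<ofℕ : ∀ C → 2 < C → 0ℝ <ℝ ofℕ C
0<ofℕ C 2<C = 0 , ℚ.≤-<-trans (ℚ.≤-reflexive (ℚ.+-identityˡ (+ 2 / 1))) (cross⇒< 2 C 1 1 (ℕ.*-monoˡ-< 1 2<C))

∣↥1/d∣≡1 : ∀ d .{{_ : NonZero d}} → ∣ ↥ (+ 1 / d) ∣ ≡ 1
∣↥1/d∣≡1 (suc d) = refl

↧1/d≡d : ∀ d .{{_ : NonZero d}} → ↧ₙ (+ 1 / d) ≡ d
↧1/d≡d (suc d) = refl

^-[/2]-lower : ∀ n k m .{{_ : NonZero n}} .{{_ : NonZero m}} →
  ∃[ s ] seq (n ^-[ k /2]) m ≡ + s / m × m ℕ.* m ≤ suc s ℕ.* suc s ℕ.* n ^ k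
^-[/2]-lower n k m = s , refl , subst (_≤ suc s ℕ.* suc s ℕ.* n ^ k) (ℕ.*-identityˡ (m ℕ.* m)) (ℕ.<⇒≤
  (subst₂ (λ p d → p ℕ.* (m ℕ.* m) < suc s ℕ.* suc s ℕ.* d) (∣↥1/d∣≡1 (n ^ k)) (↧1/d≡d (n ^ k)) (approx√-upper ∣ ↥ q ∣ (↧ₙ q) m)))
  where
  instance _ = ℕ.m^n≢0 n k
  q = + 1 / (n ^ k)
  s = approx√ ∣ ↥ q ∣ (↧ₙ q) m

-- Comparing squares leaves only the integer `n ^ k`. The approximation of `n ^-[ k /2]` is rounded
-- down to `s / L`; passing to `suc s` costs `C / L`.
fraction-≤-C*n^-[k/2] : ∀ {b m C} n k .{{_ : NonZero m}} .{{_ : NonZero n}} →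
  b ℕ.* b ℕ.* n ^ k ≤ C ℕ.* C ℕ.* (m ℕ.* m) → ∀ i .{{_ : NonZero i}} →
  + b / m ℚ.≤ seq (ofℕ C *ℝ n ^-[ k /2]) i ℚ.+ + 1 / i
fraction-≤-C*n^-[k/2] {b} {m} {C} n k h i = begin
  + b / m                                   ≤⟨ cross⇒≤ b (C ℕ.* suc s) m L (m*m≤n*n⇒m≤n bL≤) ⟩
  + (C ℕ.* suc s) / L                       ≡⟨ cong (λ z → + z / L) (trans (ℕ.*-suc C s) (ℕ.+-comm C (C ℕ.* s))) ⟩
  + (C ℕ.* s ℕ.+ C) / L                     ≃⟨ /-+ (C ℕ.* s) C L ⟩
  + (C ℕ.* s) / L ℚ.+ + C / L               ≤⟨ ℚ.+-mono-≤ (ℚ.≤-reflexive (/-* C s L)) (cross⇒≤ C 1 L i Ci≤L) ⟩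
  + C / 1 ℚ.* (+ s / L) ℚ.+ + 1 / i         ≡⟨ cong (λ z → + C / 1 ℚ.* z ℚ.+ + 1 / i) (proj₁ (proj₂ root)) ⟨
  seq (ofℕ C *ℝ n ^-[ k /2]) i ℚ.+ + 1 / i  ∎
  where
  open ℚ.≤-Reasoning
  instance _ = ℕ.m^n≢0 n k
  K = bound (ofℕ C) ℕ.⊔ bound (n ^-[ k /2])
  L = 2 ℕ.* K ℕ.* i
  instance
    _ : NonZero L
    _ = ℕ.m*n≢0 (2 ℕ.* K) i
  root = ^-[/2]-lower n k L
  s = proj₁ root
  -- The product evaluates its factors at `L = 2Ki`, and `K` is at least `bound (ofℕ C) = 2 + C`; so
  -- `C / L ≤ 1 / i`.
  Ci≤L : C ℕ.* i ≤ 1 ℕ.* L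
  Ci≤L = subst (C ℕ.* i ≤_) (sym (ℕ.*-identityˡ L)) (ℕ.*-monoˡ-≤ i
    (ℕ.≤-trans (ℕ.m≤n+m C 2) (ℕ.≤-trans (ℕ.m≤m⊔n (bound (ofℕ C)) (bound (n ^-[ k /2]))) (ℕ.m≤m+n K (K ℕ.+ 0)))))
  bL≤ : b ℕ.* L ℕ.* (b ℕ.* L) ≤ C ℕ.* suc s ℕ.* m ℕ.* (C ℕ.* suc s ℕ.* m)
  bL≤ = ℕ.*-cancelʳ-≤ _ _ (n ^ k) (ℕ≤.begin
    b ℕ.* L ℕ.* (b ℕ.* L) ℕ.* n ^ k                       ℕ≤.≡⟨ aux₁ b L (n ^ k) ⟩
    b ℕ.* b ℕ.* n ^ k ℕ.* (L ℕ.* L)                       ℕ≤.≤⟨ ℕ.*-mono-≤ h (proj₂ (proj₂ root)) ⟩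
    C ℕ.* C ℕ.* (m ℕ.* m) ℕ.* (suc s ℕ.* suc s ℕ.* n ^ k) ℕ≤.≡⟨ aux₂ C m (suc s) (n ^ k) ⟩
    C ℕ.* suc s ℕ.* m ℕ.* (C ℕ.* suc s ℕ.* m) ℕ.* n ^ k   ℕ≤.∎)
    where
    module ℕ≤ = ℕ.≤-Reasoning
    aux₁ : ∀ b L x → b ℕ.* L ℕ.* (b ℕ.* L) ℕ.* x ≡ b ℕ.* b ℕ.* x ℕ.* (L ℕ.* L)
    aux₁ = ℕSolver.solve-∀
    aux₂ : ∀ C m s x → C ℕ.* C ℕ.* (m ℕ.* m) ℕ.* (s ℕ.* s ℕ.* x) ≡ C ℕ.* s ℕ.* m ℕ.* (C ℕ.* s ℕ.* m) ℕ.* x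
    aux₂ = ℕSolver.solve-∀

-- The rational approximations add up to `I + c/m`, with total error at most `Σd/(mN)`. By `gap` the
-- true sum exceeds `I` by at least `e/(mN)`, by `Σd≤N` at most by `(c+1)/m`, and `2c≤m` keeps it at
-- least `e/(mN)` below `I + 1`.
record Certificate {k : ℕ} (a : Fin k → ℕ) (m c : ℕ) : Set where
  field
    N I e : ℕ
    A d   : Fin k → ℕ
    {{N≢0}} : NonZero N
    {{e≢0}} : NonZero e
    near  : ∀ j → Near m N (a j) (A j) (d j)
    sum-A : ℕΣ.sum A ≡ I ℕ.* m ℕ.+ c
    gap   : c ℕ.* N ≡ ℕΣ.sum d ℕ.+ e
    Σd≤N  : ℕΣ.sum d ≤ N
    2c≤m  : 2 ℕ.* c ≤ m

module _ {k : ℕ} {a : Fin k → ℕ} {m c : ℕ} .{{_ : NonZero m}} (cert : Certificate a m c) where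
  open Certificate cert
  private
    d′ = ℕΣ.sum d
    D′ = m ℕ.* N
    instance
      _ : NonZero D′
      _ = ℕ.m*n≢0 m N

  I*D/D : + (I ℕ.* D′) / D′ ≃ + I / 1
  I*D/D = cross⇒≃ (I ℕ.* D′) I D′ 1 (ℕ.*-identityʳ (I ℕ.* D′))

  sum-upper : ∀ n .{{_ : NonZero n}} → seq (∑√ a) n ℚ.≤ + I / 1 ℚ.+ + (c ℕ.* N ℕ.+ d′) / D′
  sum-upper n = begin
    seq (∑√ a) n                                     ≤⟨ ∑√-upper m N a A d near n ⟩
    + (ℕΣ.sum A ℕ.* N ℕ.+ d′) / D′                   ≡⟨ cong (λ z → + (z ℕ.* N ℕ.+ d′) / D′) sum-A ⟩
    + ((I ℕ.* m ℕ.+ c) ℕ.* N ℕ.+ d′) / D′            ≡⟨ cong (λ z → + z / D′) (aux I m c N d′) ⟩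
    + (I ℕ.* D′ ℕ.+ (c ℕ.* N ℕ.+ d′)) / D′           ≃⟨ /-+ (I ℕ.* D′) (c ℕ.* N ℕ.+ d′) D′ ⟩
    + (I ℕ.* D′) / D′ ℚ.+ + (c ℕ.* N ℕ.+ d′) / D′    ≃⟨ ℚ.+-congˡ (+ (c ℕ.* N ℕ.+ d′) / D′) I*D/D ⟩
    + I / 1 ℚ.+ + (c ℕ.* N ℕ.+ d′) / D′              ∎
    where
    open ℚ.≤-Reasoning
    aux : ∀ I m c N d → (I ℕ.* m ℕ.+ c) ℕ.* N ℕ.+ d ≡ I ℕ.* (m ℕ.* N) ℕ.+ (c ℕ.* N ℕ.+ d)
    aux = ℕSolver.solve-∀

  sum-lower : ∀ n .{{_ : NonZero n}} → + I / 1 ℚ.+ + e / D′ ℚ.≤ seq (∑√ a) n ℚ.+ + 1 / n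
  sum-lower n = +-cancelʳ-≤ (+ d′ / D′) (begin
    + I / 1 ℚ.+ + e / D′ ℚ.+ + d′ / D′                  ≃⟨ ℚ.+-congˡ (+ d′ / D′) (ℚ.+-congˡ (+ e / D′) I*D/D) ⟨
    + (I ℕ.* D′) / D′ ℚ.+ + e / D′ ℚ.+ + d′ / D′        ≃⟨ ℚ.+-congˡ (+ d′ / D′) (/-+ (I ℕ.* D′) e D′) ⟨
    + (I ℕ.* D′ ℕ.+ e) / D′ ℚ.+ + d′ / D′               ≃⟨ /-+ (I ℕ.* D′ ℕ.+ e) d′ D′ ⟨
    + (I ℕ.* D′ ℕ.+ e ℕ.+ d′) / D′                      ≡⟨ cong (λ z → + z / D′) eq ⟩
    + (ℕΣ.sum A ℕ.* N) / D′                             ≤⟨ ∑√-lower m N a A d near n ⟩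
    seq (∑√ a) n ℚ.+ (+ d′ / D′ ℚ.+ + 1 / n)            ≃⟨ aux (seq (∑√ a) n) (+ d′ / D′) (+ 1 / n) ⟩
    seq (∑√ a) n ℚ.+ + 1 / n ℚ.+ + d′ / D′              ∎)
    where
    open ℚ.≤-Reasoning
    open ℚSolver.+-*-Solver using (solve; _:=_; _:+_)
    aux : ∀ s d h → s ℚ.+ (d ℚ.+ h) ≃ s ℚ.+ h ℚ.+ d
    aux = solve 3 (λ s d h → s :+ (d :+ h) := s :+ h :+ d) ℚ.≃-refl
    aux₁ : ∀ I m N e d → I ℕ.* (m ℕ.* N) ℕ.+ e ℕ.+ d ≡ I ℕ.* m ℕ.* N ℕ.+ (d ℕ.+ e)
    aux₁ = ℕSolver.solve-∀
    eq : I ℕ.* D′ ℕ.+ e ℕ.+ d′ ≡ ℕΣ.sum A ℕ.* N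
    eq = trans (aux₁ I m N e d′) (trans (cong (I ℕ.* m ℕ.* N ℕ.+_) (sym gap))
      (trans (sym (ℕ.*-distribʳ-+ N (I ℕ.* m) c)) (cong (ℕ._* N) (sym sum-A))))

  ‖∑√‖-upper : ∀ n .{{_ : NonZero n}} → ‖ seq (∑√ a) n ‖ℚ ℚ.≤ + suc c / m ℚ.+ + 1 / n
  ‖∑√‖-upper n = ℚ.≤-trans (‖q‖≤∣q-m∣ S (+ I)) (close S≤ I≤)
    where
    open ℚ.≤-Reasoning
    S = seq (∑√ a) n
    r≤ : + (c ℕ.* N ℕ.+ d′) / D′ ℚ.≤ + suc c / m
    r≤ = cross⇒≤ (c ℕ.* N ℕ.+ d′) (suc c) D′ m (subst ((c ℕ.* N ℕ.+ d′) ℕ.* m ≤_) (aux c N m)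
      (ℕ.*-monoˡ-≤ m (ℕ.+-monoʳ-≤ (c ℕ.* N) Σd≤N)))
      where
      aux : ∀ c N m → (c ℕ.* N ℕ.+ N) ℕ.* m ≡ (1 ℕ.+ c) ℕ.* (m ℕ.* N)
      aux = ℕSolver.solve-∀
    S≤ : S ℚ.≤ + I / 1 ℚ.+ (+ suc c / m ℚ.+ + 1 / n)
    S≤ = begin
      S                                               ≤⟨ sum-upper n ⟩
      + I / 1 ℚ.+ + (c ℕ.* N ℕ.+ d′) / D′             ≤⟨ ℚ.+-monoʳ-≤ (+ I / 1) r≤ ⟩
      + I / 1 ℚ.+ + suc c / m                         ≃⟨ ℚ.+-congʳ (+ I / 1) (ℚ.≃-sym (ℚ.+-identityʳ (+ suc c / m))) ⟩
      + I / 1 ℚ.+ (+ suc c / m ℚ.+ 0ℚᵘ)               ≤⟨ ℚ.+-monoʳ-≤ (+ I / 1) (ℚ.+-monoʳ-≤ (+ suc c / m) (0≤1/n n)) ⟩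
      + I / 1 ℚ.+ (+ suc c / m ℚ.+ + 1 / n)           ∎
    I≤ : + I / 1 ℚ.≤ S ℚ.+ (+ suc c / m ℚ.+ + 1 / n)
    I≤ = begin
      + I / 1                                         ≃⟨ ℚ.+-identityʳ (+ I / 1) ⟨
      + I / 1 ℚ.+ 0ℚᵘ                                 ≤⟨ ℚ.+-monoʳ-≤ (+ I / 1) (0≤x/n e D′) ⟩
      + I / 1 ℚ.+ + e / D′                            ≤⟨ sum-lower n ⟩
      S ℚ.+ + 1 / n                                   ≃⟨ ℚ.+-congʳ S (ℚ.≃-sym (ℚ.+-identityˡ (+ 1 / n))) ⟩
      S ℚ.+ (0ℚᵘ ℚ.+ + 1 / n)                         ≤⟨ ℚ.+-monoʳ-≤ S (ℚ.+-monoˡ-≤ (+ 1 / n) (0≤x/n (suc c) m)) ⟩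
      S ℚ.+ (+ suc c / m ℚ.+ + 1 / n)                 ∎

  -- Let `J` be the integer nearest to the approximation: if `J ≤ I`, the excess over `I` gives the
  -- bound; otherwise the room below `I + 1` does.
  ‖∑√‖-lower : ∀ n .{{_ : NonZero n}} → + e / D′ ℚ.≤ ‖ seq (∑√ a) n ‖ℚ ℚ.+ + 1 / n
  ‖∑√‖-lower n with ‖q‖-attained (seq (∑√ a) n)
  ... | J , ‖S‖≃ = ℚ.≤-trans bnd (ℚ.≤-reflexive (ℚ.+-congˡ (+ 1 / n) (ℚ.≃-sym ‖S‖≃)))
    where
    open ℚ.≤-Reasoning
    S = seq (∑√ a) n
    bnd : + e / D′ ℚ.≤ ℚ.∣ S ℚ.- J / 1 ∣ ℚ.+ + 1 / n
    bnd with J ℤ.≤? + I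
    ... | yes J≤I = begin
      + e / D′                              ≤⟨ p+q≤r⇒p≤r-q (ℚ.≤-trans (ℚ.≤-reflexive (ℚ.+-comm (+ e / D′) (+ I / 1))) (sum-lower n)) ⟩
      S ℚ.+ + 1 / n ℚ.- + I / 1             ≃⟨ aux S (+ 1 / n) (+ I / 1) ⟩
      S ℚ.- + I / 1 ℚ.+ + 1 / n             ≤⟨ ℚ.+-monoˡ-≤ (+ 1 / n) (ℚ.+-monoʳ-≤ S (ℚ.neg-mono-≤ (ℤ/1-mono J≤I))) ⟩
      S ℚ.- J / 1 ℚ.+ + 1 / n               ≤⟨ ℚ.+-monoˡ-≤ (+ 1 / n) (p≤∣p∣ (S ℚ.- J / 1)) ⟩
      ℚ.∣ S ℚ.- J / 1 ∣ ℚ.+ + 1 / n         ∎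
      where
      open ℚSolver.+-*-Solver using (solve; _:=_; _:+_; _:-_)
      aux : ∀ s h i → s ℚ.+ h ℚ.- i ≃ s ℚ.- i ℚ.+ h
      aux = solve 3 (λ s h i → s :+ h :- i := s :- i :+ h) ℚ.≃-refl
    ... | no J≰I = begin
      + e / D′                              ≤⟨ p+q≤r⇒p≤r-q e+S≤J ⟩
      J / 1 ℚ.- S                           ≤⟨ p≤∣p∣ (J / 1 ℚ.- S) ⟩
      ℚ.∣ J / 1 ℚ.- S ∣                     ≃⟨ ∣p-q∣≃∣q-p∣ (J / 1) S ⟩
      ℚ.∣ S ℚ.- J / 1 ∣                     ≃⟨ ℚ.+-identityʳ ℚ.∣ S ℚ.- J / 1 ∣ ⟨
      ℚ.∣ S ℚ.- J / 1 ∣ ℚ.+ 0ℚᵘ             ≤⟨ ℚ.+-monoʳ-≤ ℚ.∣ S ℚ.- J / 1 ∣ (0≤1/n n) ⟩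
      ℚ.∣ S ℚ.- J / 1 ∣ ℚ.+ + 1 / n         ∎
      where
      r = c ℕ.* N ℕ.+ d′
      fits : (e ℕ.+ (I ℕ.* D′ ℕ.+ r)) ℕ.* 1 ≤ suc I ℕ.* D′
      fits = ℕ≤.begin
        (e ℕ.+ (I ℕ.* D′ ℕ.+ r)) ℕ.* 1                       ℕ≤.≡⟨ aux₁ e (I ℕ.* D′) (c ℕ.* N) d′ ⟩
        c ℕ.* N ℕ.+ (d′ ℕ.+ e) ℕ.+ I ℕ.* D′                  ℕ≤.≡⟨ cong (λ z → c ℕ.* N ℕ.+ z ℕ.+ I ℕ.* D′) gap ⟨
        c ℕ.* N ℕ.+ c ℕ.* N ℕ.+ I ℕ.* D′                     ℕ≤.≡⟨ cong (ℕ._+ I ℕ.* D′) (aux₂ c N) ⟩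
        2 ℕ.* c ℕ.* N ℕ.+ I ℕ.* D′                           ℕ≤.≤⟨ ℕ.+-monoˡ-≤ (I ℕ.* D′) (ℕ.*-monoˡ-≤ N 2c≤m) ⟩
        suc I ℕ.* D′                                         ℕ≤.∎
        where
        module ℕ≤ = ℕ.≤-Reasoning
        aux₁ : ∀ e i x d → (e ℕ.+ (i ℕ.+ (x ℕ.+ d))) ℕ.* 1 ≡ x ℕ.+ (d ℕ.+ e) ℕ.+ i
        aux₁ = ℕSolver.solve-∀
        aux₂ : ∀ c N → c ℕ.* N ℕ.+ c ℕ.* N ≡ 2 ℕ.* c ℕ.* N
        aux₂ = ℕSolver.solve-∀
      e+S≤J : + e / D′ ℚ.+ S ℚ.≤ J / 1
      e+S≤J = begin
        + e / D′ ℚ.+ S                                          ≤⟨ ℚ.+-monoʳ-≤ (+ e / D′) (sum-upper n) ⟩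
        + e / D′ ℚ.+ (+ I / 1 ℚ.+ + r / D′)                     ≃⟨ ℚ.+-congʳ (+ e / D′) (ℚ.+-congˡ (+ r / D′) I*D/D) ⟨
        + e / D′ ℚ.+ (+ (I ℕ.* D′) / D′ ℚ.+ + r / D′)           ≃⟨ ℚ.+-congʳ (+ e / D′) (/-+ (I ℕ.* D′) r D′) ⟨
        + e / D′ ℚ.+ + (I ℕ.* D′ ℕ.+ r) / D′                    ≃⟨ /-+ e (I ℕ.* D′ ℕ.+ r) D′ ⟨
        + (e ℕ.+ (I ℕ.* D′ ℕ.+ r)) / D′                         ≤⟨ cross⇒≤ (e ℕ.+ (I ℕ.* D′ ℕ.+ r)) (suc I) D′ 1 fits ⟩
        + suc I / 1                                             ≤⟨ ℤ/1-mono (ℤ.i<j⇒suc[i]≤j (ℤ.≰⇒> J≰I)) ⟩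
        J / 1                                                   ∎

  0<‖∑√‖ : 0ℝ <ℝ ‖ ∑√ a ‖
  -- For `M = 3mN + 1`, `e/(mN) ≥ 1/(mN) > 3/M`: two parts are the slack in `_<ℝ_`, one is the loss
  -- in `‖∑√‖-lower`.
  0<‖∑√‖ = 3 ℕ.* D′ , ℚ.≤-<-trans (ℚ.≤-reflexive (ℚ.+-identityˡ (+ 2 / suc (3 ℕ.* D′)))) (ℚ.≰⇒> λ ‖S‖≤ →
    ℚ.<⇒≱ (cross⇒< 3 e (suc (3 ℕ.* D′)) D′ 3D<) (begin
      + e / D′                                                ≤⟨ ‖∑√‖-lower (suc (3 ℕ.* D′)) ⟩
      ‖ seq (∑√ a) (suc (3 ℕ.* D′)) ‖ℚ ℚ.+ + 1 / suc (3 ℕ.* D′)   ≤⟨ ℚ.+-monoˡ-≤ (+ 1 / suc (3 ℕ.* D′)) ‖S‖≤ ⟩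
      + 2 / suc (3 ℕ.* D′) ℚ.+ + 1 / suc (3 ℕ.* D′)           ≃⟨ /-+ 2 1 (suc (3 ℕ.* D′)) ⟨
      + 3 / suc (3 ℕ.* D′)                                    ∎))
    where
    open ℚ.≤-Reasoning
    3D< : 3 ℕ.* D′ < e ℕ.* suc (3 ℕ.* D′)
    3D< = ℕ.m≤n*m (suc (3 ℕ.* D′)) e

  -- The slack `2/i` of `_≤ℝ_` is used up by two losses of `1/i`, one from the sum of roots and one
  -- from the product.
  ‖∑√‖≤C*n^-[k/2] : ∀ {C} n l .{{_ : NonZero n}} → suc c ℕ.* suc c ℕ.* n ^ l ≤ C ℕ.* C ℕ.* (m ℕ.* m) →
    ‖ ∑√ a ‖ ≤ℝ ofℕ C *ℝ n ^-[ l /2]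
  ‖∑√‖≤C*n^-[k/2] {C} n l h i = begin
    ‖ seq (∑√ a) i ‖ℚ                                       ≤⟨ ‖∑√‖-upper i ⟩
    + suc c / m ℚ.+ + 1 / i                                 ≤⟨ ℚ.+-monoˡ-≤ (+ 1 / i) (fraction-≤-C*n^-[k/2] {suc c} {m} {C} n l h i) ⟩
    seq (ofℕ C *ℝ n ^-[ l /2]) i ℚ.+ + 1 / i ℚ.+ + 1 / i    ≃⟨ ℚ.+-assoc (seq (ofℕ C *ℝ n ^-[ l /2]) i) (+ 1 / i) (+ 1 / i) ⟩
    seq (ofℕ C *ℝ n ^-[ l /2]) i ℚ.+ (+ 1 / i ℚ.+ + 1 / i)  ≃⟨ ℚ.+-congʳ (seq (ofℕ C *ℝ n ^-[ l /2]) i) (/-+ 1 1 i) ⟨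
    seq (ofℕ C *ℝ n ^-[ l /2]) i ℚ.+ + 2 / i                ∎
    where open ℚ.≤-Reasoning

-- The construction

∣i∣≤n⇒n+i≡∸ : ∀ n i → ∣ i ∣ ≤ n → ∃[ p ] + n ℤ.+ i ≡ + p × n ≤ p ℕ.+ ∣ i ∣ × p ≤ n ℕ.+ ∣ i ∣
∣i∣≤n⇒n+i≡∸ n (+ i)    _ = n ℕ.+ i , refl , ℕ.≤-trans (ℕ.m≤m+n n i) (ℕ.m≤m+n (n ℕ.+ i) i) , ℕ.≤-refl
∣i∣≤n⇒n+i≡∸ n -[1+ i ] h with ℕ.m≤n⇒∃[o]m+o≡n h
... | o , refl = o , aux (+ suc i) (+ o) , ℕ.≤-reflexive (ℕ.+-comm (suc i) o) ,
                 ℕ.≤-trans (ℕ.m≤n+m o (suc i)) (ℕ.m≤m+n (suc i ℕ.+ o) (suc i))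
  where
  aux : ∀ i o → i ℤ.+ o ℤ.+ ℤ.- i ≡ o
  aux = solve-∀

∣m-n∣≤e⇒m≤n+e : ∀ m n {e} → ∣ + m ℤ.- + n ∣ ≤ e → m ≤ n ℕ.+ e
∣m-n∣≤e⇒m≤n+e m n {e} h = begin
  m                              ≡⟨⟩
  ∣ + m ∣                        ≡⟨ cong ∣_∣ (aux (+ m) (+ n)) ⟩
  ∣ + n ℤ.+ (+ m ℤ.- + n) ∣      ≤⟨ ℤ.∣i+j∣≤∣i∣+∣j∣ (+ n) (+ m ℤ.- + n) ⟩
  n ℕ.+ ∣ + m ℤ.- + n ∣          ≤⟨ ℕ.+-monoʳ-≤ n h ⟩
  n ℕ.+ e                        ∎
  where
  open ℕ.≤-Reasoning
  aux : ∀ m n → m ≡ n ℤ.+ (m ℤ.- n)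
  aux = solve-∀

rising≥N^ : ∀ k N → N ^ k ≤ rising k N
rising≥N^ zero    N = ℕ.≤-refl
rising≥N^ (suc k) N = ℕ.*-mono-≤ (ℕ.m≤m+n N k) (rising≥N^ k N)

-- For `x > 0`, `a` is `x²((N+b)² + 4s)`. Modulo multiples of `rising k N`, `A` is linear in the
-- weight and the coefficients, so the relations among coefficients carry over to sums of terms.
record Term (k x : ℕ) (g : Generator) (d G N : ℕ) : Set where
  field
    a A I   : ℕ
    a≥1     : 1 ≤ a
    a≤GN²   : a ≤ G ℕ.* (N ℕ.* N)
    near    : Near (rising k N) N a A d
    A-split : + A ≡ + I ℤ.* + rising k N ℤ.+ + x ℤ.* numerator (coefs g) k N

term : ∀ k x g → ∃[ N₀ ] ∃[ d ] ∃[ G ] (∀ N .{{_ : NonZero N}} → N₀ ≤ N → Term k x g d G N)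
-- A generator of weight 0 contributes √1, an integer, since every a_j has to be positive.
term k zero g = 0 , 0 , 1 , λ N _ → record
  { a = 1 ; A = rising k N ; I = 1 ; a≥1 = ℕ.≤-refl
  ; a≤GN² = ℕ.*-monoʳ-≤ 1 (ℕ.*-mono-≤ (ℕ.>-nonZero⁻¹ N) (ℕ.>-nonZero⁻¹ N))
  ; near = record
    { upper = ℕ.≤-reflexive (trans (cong (N ℕ.*_) (ℕ.*-identityˡ (rising k N ℕ.* rising k N))) (sym (ℕ.+-identityʳ _)))
    ; lower = ℕ.≤-reflexive (trans (cong (N ℕ.*_) (sym (ℕ.*-identityˡ (rising k N ℕ.* rising k N)))) (sym (ℕ.+-identityʳ _))) }
  ; A-split = aux (+ rising k N) (numerator (coefs g) k N) }
  where
  aux : ∀ m q → m ≡ 1ℤ ℤ.* m ℤ.+ 0ℤ ℤ.* q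
  aux = solve-∀
-- `q` and `E` bound the numerator and the residual. `N ≥ 2q` gives `2p ≥ N^(k+1)` for the
-- approximant `p`, which turns the residual bound `E · N^k` into the error `2Ex`; `N > ∣4s∣` makes
-- the radicand positive. `G` comes from `N + b ≤ (1 + b)N`.
term k x@(suc _) (s , b) = 2 ℕ.* q ℕ.+ suc ∣ + 4 ℤ.* s ∣ , 2 ℕ.* E ℕ.* x , x ℕ.* x ℕ.* (suc b ℕ.* suc b ℕ.+ ∣ + 4 ℤ.* s ∣) , go
  where
  v = coef s b
  E = O.constant (O-residual s b k)
  q = O.constant (O-numerator v k)
  go : ∀ N .{{_ : NonZero N}} → 2 ℕ.* q ℕ.+ suc ∣ + 4 ℤ.* s ∣ ≤ N → Term k x (s , b) _ _ N
  go N N₀≤N = record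
    { a = x ℕ.* x ℕ.* r ; A = x ℕ.* p ; I = x ℕ.* (N ℕ.+ b)
    ; a≥1 = ℕ.*-mono-≤ {1} {x ℕ.* x} (s≤s z≤n) r≥1
    ; a≤GN² = a≤
    ; near = record { upper = near-upper ; lower = near-lower }
    ; A-split = A-split }
    where
    open ℕ.≤-Reasoning
    m = rising k N
    y = N ℕ.+ b
    t = ∣ + 4 ℤ.* s ∣
    N≤yy : N ≤ y ℕ.* y
    N≤yy = ℕ.≤-trans (ℕ.m≤m*n N N) (ℕ.*-mono-≤ (ℕ.m≤m+n N b) (ℕ.m≤m+n N b))
    1+t≤yy : suc t ≤ y ℕ.* y
    1+t≤yy = ℕ.≤-trans (ℕ.≤-trans (ℕ.m≤n+m (suc t) (2 ℕ.* q)) N₀≤N) N≤yy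
    radicand = ∣i∣≤n⇒n+i≡∸ (y ℕ.* y) (+ 4 ℤ.* s) (ℕ.≤-trans (ℕ.n≤1+n t) 1+t≤yy)
    r = proj₁ radicand
    r≥1 : 1 ≤ r
    r≥1 = ℕ.+-cancelʳ-≤ t 1 r (ℕ.≤-trans 1+t≤yy (proj₁ (proj₂ (proj₂ radicand))))
    qN^k≤ : 2 ℕ.* (q ℕ.* N ^ k) ≤ N ^ suc k
    qN^k≤ = subst (_≤ N ^ suc k) (ℕ.*-assoc 2 q (N ^ k)) (ℕ.*-monoˡ-≤ (N ^ k) (ℕ.≤-trans (ℕ.m≤m+n (2 ℕ.* q) (suc t)) N₀≤N))
    my≥ : N ^ suc k ≤ m ℕ.* y
    my≥ = subst (N ^ suc k ≤_) (ℕ.*-comm y m) (ℕ.*-mono-≤ (ℕ.m≤m+n N b) (rising≥N^ k N))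
    ∣numerator∣≤ : 2 ℕ.* ∣ numerator v k N ∣ ≤ N ^ suc k
    ∣numerator∣≤ = ℕ.≤-trans (ℕ.*-monoʳ-≤ 2 (O.bounded (O-numerator v k) N)) qN^k≤
    root = ∣i∣≤n⇒n+i≡∸ (m ℕ.* y) (numerator v k N) (ℕ.≤-trans (ℕ.m≤m+n ∣ numerator v k N ∣ _) (ℕ.≤-trans ∣numerator∣≤ my≥))
    p = proj₁ root
    approximant≡p : approximant v b k N ≡ + p
    approximant≡p = trans (cong (ℤ._+ numerator v k N) (sym (ℤ.pos-* m y))) (proj₁ (proj₂ root))
    N^≤2p : N ^ suc k ≤ 2 ℕ.* p
    N^≤2p = ℕ.+-cancelʳ-≤ (N ^ suc k) (N ^ suc k) (2 ℕ.* p) (begin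
      N ^ suc k ℕ.+ N ^ suc k              ≡⟨ cong (N ^ suc k ℕ.+_) (ℕ.+-identityʳ (N ^ suc k)) ⟨
      2 ℕ.* N ^ suc k                      ≤⟨ ℕ.*-monoʳ-≤ 2 (ℕ.≤-trans my≥ (proj₁ (proj₂ (proj₂ root)))) ⟩
      2 ℕ.* (p ℕ.+ ∣ numerator v k N ∣)            ≡⟨ ℕ.*-distribˡ-+ 2 p ∣ numerator v k N ∣ ⟩
      2 ℕ.* p ℕ.+ 2 ℕ.* ∣ numerator v k N ∣        ≤⟨ ℕ.+-monoʳ-≤ (2 ℕ.* p) ∣numerator∣≤ ⟩
      2 ℕ.* p ℕ.+ N ^ suc k                ∎)
    residual≡ : residual s v b k N ≡ + (m ℕ.* m ℕ.* r) ℤ.- + (p ℕ.* p)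
    residual≡ = cong₂ ℤ._-_
      (trans (cong₂ ℤ._*_ (sym (ℤ.pos-* m m)) (trans (cong (ℤ._+ + 4 ℤ.* s) (sym (ℤ.pos-* y y))) (proj₁ (proj₂ radicand)))) (sym (ℤ.pos-* (m ℕ.* m) r)))
      (trans (cong₂ ℤ._*_ approximant≡p approximant≡p) (sym (ℤ.pos-* p p)))
    ∣residual∣≤ : ∣ + (m ℕ.* m ℕ.* r) ℤ.- + (p ℕ.* p) ∣ ≤ E ℕ.* N ^ k
    ∣residual∣≤ = subst (λ z → ∣ z ∣ ≤ E ℕ.* N ^ k) residual≡ (O.bounded (O-residual s b k) N)
    error≤ : N ℕ.* (x ℕ.* x) ℕ.* (E ℕ.* N ^ k) ≤ 2 ℕ.* E ℕ.* x ℕ.* (x ℕ.* p)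
    error≤ = begin
      N ℕ.* (x ℕ.* x) ℕ.* (E ℕ.* N ^ k)     ≡⟨ aux₁ N x E (N ^ k) ⟩
      x ℕ.* x ℕ.* E ℕ.* N ^ suc k           ≤⟨ ℕ.*-monoʳ-≤ (x ℕ.* x ℕ.* E) N^≤2p ⟩
      x ℕ.* x ℕ.* E ℕ.* (2 ℕ.* p)           ≡⟨ aux₂ x E p ⟩
      2 ℕ.* E ℕ.* x ℕ.* (x ℕ.* p)           ∎
      where
      aux₁ : ∀ N x E z → N ℕ.* (x ℕ.* x) ℕ.* (E ℕ.* z) ≡ x ℕ.* x ℕ.* E ℕ.* (N ℕ.* z)
      aux₁ = ℕSolver.solve-∀
      aux₂ : ∀ x E p → x ℕ.* x ℕ.* E ℕ.* (2 ℕ.* p) ≡ 2 ℕ.* E ℕ.* x ℕ.* (x ℕ.* p)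
      aux₂ = ℕSolver.solve-∀
    ring₁ : ∀ N x r m → N ℕ.* (x ℕ.* x ℕ.* r ℕ.* (m ℕ.* m)) ≡ N ℕ.* (x ℕ.* x) ℕ.* (m ℕ.* m ℕ.* r)
    ring₁ = ℕSolver.solve-∀
    ring₂ : ∀ N x p → N ℕ.* (x ℕ.* p ℕ.* (x ℕ.* p)) ≡ N ℕ.* (x ℕ.* x) ℕ.* (p ℕ.* p)
    ring₂ = ℕSolver.solve-∀
    near-upper : N ℕ.* (x ℕ.* x ℕ.* r ℕ.* (m ℕ.* m)) ≤ N ℕ.* (x ℕ.* p ℕ.* (x ℕ.* p)) ℕ.+ 2 ℕ.* E ℕ.* x ℕ.* (x ℕ.* p)
    near-upper = begin
      N ℕ.* (x ℕ.* x ℕ.* r ℕ.* (m ℕ.* m))                                      ≡⟨ ring₁ N x r m ⟩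
      N ℕ.* (x ℕ.* x) ℕ.* (m ℕ.* m ℕ.* r)                                      ≤⟨ ℕ.*-monoʳ-≤ (N ℕ.* (x ℕ.* x)) (∣m-n∣≤e⇒m≤n+e (m ℕ.* m ℕ.* r) (p ℕ.* p) ∣residual∣≤) ⟩
      N ℕ.* (x ℕ.* x) ℕ.* (p ℕ.* p ℕ.+ E ℕ.* N ^ k)                            ≡⟨ ℕ.*-distribˡ-+ (N ℕ.* (x ℕ.* x)) (p ℕ.* p) (E ℕ.* N ^ k) ⟩
      N ℕ.* (x ℕ.* x) ℕ.* (p ℕ.* p) ℕ.+ N ℕ.* (x ℕ.* x) ℕ.* (E ℕ.* N ^ k)      ≤⟨ ℕ.+-mono-≤ (ℕ.≤-reflexive (sym (ring₂ N x p))) error≤ ⟩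
      N ℕ.* (x ℕ.* p ℕ.* (x ℕ.* p)) ℕ.+ 2 ℕ.* E ℕ.* x ℕ.* (x ℕ.* p)            ∎
    near-lower : N ℕ.* (x ℕ.* p ℕ.* (x ℕ.* p)) ≤ N ℕ.* (x ℕ.* x ℕ.* r ℕ.* (m ℕ.* m)) ℕ.+ 2 ℕ.* E ℕ.* x ℕ.* (x ℕ.* p)
    near-lower = begin
      N ℕ.* (x ℕ.* p ℕ.* (x ℕ.* p))                                            ≡⟨ ring₂ N x p ⟩
      N ℕ.* (x ℕ.* x) ℕ.* (p ℕ.* p)                                            ≤⟨ ℕ.*-monoʳ-≤ (N ℕ.* (x ℕ.* x)) (∣m-n∣≤e⇒m≤n+e (p ℕ.* p) (m ℕ.* m ℕ.* r)
                                                                                    (subst (_≤ E ℕ.* N ^ k) (ℤ.∣i-j∣≡∣j-i∣ (+ (m ℕ.* m ℕ.* r)) (+ (p ℕ.* p))) ∣residual∣≤)) ⟩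
      N ℕ.* (x ℕ.* x) ℕ.* (m ℕ.* m ℕ.* r ℕ.+ E ℕ.* N ^ k)                      ≡⟨ ℕ.*-distribˡ-+ (N ℕ.* (x ℕ.* x)) (m ℕ.* m ℕ.* r) (E ℕ.* N ^ k) ⟩
      N ℕ.* (x ℕ.* x) ℕ.* (m ℕ.* m ℕ.* r) ℕ.+ N ℕ.* (x ℕ.* x) ℕ.* (E ℕ.* N ^ k) ≤⟨ ℕ.+-mono-≤ (ℕ.≤-reflexive (sym (ring₁ N x r m))) error≤ ⟩
      N ℕ.* (x ℕ.* x ℕ.* r ℕ.* (m ℕ.* m)) ℕ.+ 2 ℕ.* E ℕ.* x ℕ.* (x ℕ.* p)      ∎
    a≤ : x ℕ.* x ℕ.* r ≤ x ℕ.* x ℕ.* (suc b ℕ.* suc b ℕ.+ t) ℕ.* (N ℕ.* N)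
    a≤ = begin
      x ℕ.* x ℕ.* r                                                  ≤⟨ ℕ.*-monoʳ-≤ (x ℕ.* x) (proj₂ (proj₂ (proj₂ radicand))) ⟩
      x ℕ.* x ℕ.* (y ℕ.* y ℕ.+ t)                                    ≤⟨ ℕ.*-monoʳ-≤ (x ℕ.* x) (ℕ.+-mono-≤ (ℕ.*-mono-≤ y≤ y≤) (ℕ.m≤m*n t (N ℕ.* N) {{ℕ.m*n≢0 N N}})) ⟩
      x ℕ.* x ℕ.* (suc b ℕ.* N ℕ.* (suc b ℕ.* N) ℕ.+ t ℕ.* (N ℕ.* N)) ≡⟨ aux x (suc b) N t ⟩
      x ℕ.* x ℕ.* (suc b ℕ.* suc b ℕ.+ t) ℕ.* (N ℕ.* N)              ∎
      where
      y≤ : y ≤ suc b ℕ.* N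
      y≤ = ℕ.+-monoʳ-≤ N (ℕ.m≤m*n b N)
      aux : ∀ x b N t → x ℕ.* x ℕ.* (b ℕ.* N ℕ.* (b ℕ.* N) ℕ.+ t ℕ.* (N ℕ.* N)) ≡ x ℕ.* x ℕ.* (b ℕ.* b ℕ.+ t) ℕ.* (N ℕ.* N)
      aux = ℕSolver.solve-∀
    A-split : + (x ℕ.* p) ≡ + (x ℕ.* y) ℤ.* + m ℤ.+ + x ℤ.* numerator v k N
    A-split = trans (ℤ.pos-* x p) (trans (cong (+ x ℤ.*_) (sym approximant≡p)) (trans (aux (+ x) (+ m) (+ y) (numerator v k N))
      (cong (λ z → z ℤ.* + m ℤ.+ + x ℤ.* numerator v k N) (sym (ℤ.pos-* x y)))))
      where
      aux : ∀ x m y q → x ℤ.* (m ℤ.* y ℤ.+ q) ≡ x ℤ.* y ℤ.* m ℤ.+ x ℤ.* q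
      aux = solve-∀

-- Adding up the k terms

≤-sum : ∀ {k} (f : Fin k → ℕ) j → f j ≤ ℕΣ.sum f
≤-sum f zero    = ℕ.m≤m+n (f zero) _
≤-sum f (suc j) = ℕ.≤-trans (≤-sum (λ j → f (suc j)) j) (ℕ.m≤n+m _ (f zero))

pos-sum : ∀ {k} (f : Fin k → ℕ) → + ℕΣ.sum f ≡ ℤΣ.sum (λ j → + f j)
pos-sum {zero}  f = refl
pos-sum {suc k} f = cong (λ z → + f zero ℤ.+ z) (pos-sum (λ j → f (suc j)))

sum-const : ∀ k c → ℕΣ.sum {k} (λ _ → c) ≡ k ℕ.* c
sum-const zero    c = refl
sum-const (suc k) c = cong (c ℕ.+_) (sum-const k c)

numerator-linear : ∀ {n} (x : Fin n → ℕ) (v : Fin n → ℕ → ℤ) k N →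
  ℤΣ.sum (λ j → + x j ℤ.* numerator (v j) k N) ≡ numerator (λ i → ℤΣ.sum (λ j → + x j ℤ.* v j i)) k N
numerator-linear x v zero    N = sum-zero (λ j → + x j ℤ.* 0ℤ) λ j → ℤ.*-zeroʳ (+ x j)
numerator-linear x v (suc k) N = begin
  ℤΣ.sum (λ j → + x j ℤ.* (n ℤ.* numerator (v j) k N ℤ.+ v j k))
    ≡⟨ ℤΣ.sum-cong-≗ (λ j → aux (+ x j) n (numerator (v j) k N) (v j k)) ⟩
  ℤΣ.sum (λ j → n ℤ.* (+ x j ℤ.* numerator (v j) k N) ℤ.+ + x j ℤ.* v j k)
    ≡⟨ ℤΣ.∑-distrib-+ (λ j → n ℤ.* (+ x j ℤ.* numerator (v j) k N)) (λ j → + x j ℤ.* v j k) ⟩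
  ℤΣ.sum (λ j → n ℤ.* (+ x j ℤ.* numerator (v j) k N)) ℤ.+ ℤΣ.sum (λ j → + x j ℤ.* v j k)
    ≡⟨ cong (ℤ._+ ℤΣ.sum (λ j → + x j ℤ.* v j k)) (ℤΣ.*-distribˡ-sum n (λ j → + x j ℤ.* numerator (v j) k N)) ⟨
  n ℤ.* ℤΣ.sum (λ j → + x j ℤ.* numerator (v j) k N) ℤ.+ ℤΣ.sum (λ j → + x j ℤ.* v j k)
    ≡⟨ cong (λ z → n ℤ.* z ℤ.+ ℤΣ.sum (λ j → + x j ℤ.* v j k)) (numerator-linear x v k N) ⟩
  numerator (λ i → ℤΣ.sum (λ j → + x j ℤ.* v j i)) (suc k) N ∎
  where
  open ≡-Reasoning
  n = + (N ℕ.+ k)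
  aux : ∀ x n q v → x ℤ.* (n ℤ.* q ℤ.+ v) ≡ n ℤ.* (x ℤ.* q) ℤ.+ x ℤ.* v
  aux = solve-∀

numerator-zero : ∀ v k N → (∀ i → i < k → v i ≡ 0ℤ) → numerator v k N ≡ 0ℤ
numerator-zero v zero    N h = refl
numerator-zero v (suc k) N h = trans (cong₂ (λ a b → + (N ℕ.+ k) ℤ.* a ℤ.+ b)
  (numerator-zero v k N λ i i<k → h i (ℕ.<-trans i<k (ℕ.n<1+n k))) (h k (ℕ.n<1+n k))) (cong (ℤ._+ 0ℤ) (ℤ.*-zeroʳ (+ (N ℕ.+ k))))

construction : ∀ κ → let k = suc κ in ∃[ c ] ∃[ G ] ∃[ N₀ ] (∀ N .{{_ : NonZero N}} → N₀ ≤ N →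
  Σ[ a ∈ (Fin k → ℕ) ] (∀ j → 1 ≤ a j × a j ≤ G ℕ.* (N ℕ.* N)) × Certificate a (rising k N) c)
construction κ with both-signs κ
... | V , _ , p , _ , hV , _ with carathéodory (suc κ) V
-- Besides the thresholds of the terms, `N > Σd` lets `cN` exceed the total error, and `N ≥ 2c`
-- gives `2c ≤ rising k N`. A sum of thresholds dominates each of them.
...   | g , x , Y , eq = c , ℕΣ.sum G , ℕΣ.sum N₀ ℕ.+ (suc (ℕΣ.sum d) ℕ.+ 2 ℕ.* c) , build
  where
  k = suc κ
  c = suc Y ℕ.* suc p
  N₀ d G : Fin k → ℕ
  N₀ j = proj₁ (term k (x j) (g j))
  d j = proj₁ (proj₂ (term k (x j) (g j)))
  G j = proj₁ (proj₂ (proj₂ (term k (x j) (g j))))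
  u : ℕ → ℤ
  u i = ℤΣ.sum (λ j → + x j ℤ.* coefs (g j) i)
  -- The index `κ = k - 1` is the last one kept, and its term has denominator exactly `rising k N`;
  -- so the numerator does not vary with `N`.
  Qu : ∀ N → numerator u k N ≡ + c
  Qu N = trans (cong₂ (λ a b → + (N ℕ.+ κ) ℤ.* a ℤ.+ b)
      (numerator-zero u κ N λ i i<κ → trans (eq i (ℕ.<-trans i<κ (ℕ.n<1+n κ))) (trans (cong (+ suc Y ℤ.*_) (hV .Leading.below i i<κ)) (ℤ.*-zeroʳ (+ suc Y))))
      (trans (eq κ (ℕ.n<1+n κ)) (trans (cong (+ suc Y ℤ.*_) (hV .Leading.at)) (sym (ℤ.pos-* (suc Y) (suc p))))))
    (cong (ℤ._+ + c) (ℤ.*-zeroʳ (+ (N ℕ.+ κ))))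
  build : ∀ N .{{_ : NonZero N}} → ℕΣ.sum N₀ ℕ.+ (suc (ℕΣ.sum d) ℕ.+ 2 ℕ.* c) ≤ N →
    Σ[ a ∈ (Fin k → ℕ) ] (∀ j → 1 ≤ a j × a j ≤ ℕΣ.sum G ℕ.* (N ℕ.* N)) × Certificate a (rising k N) c
  build N N≥ = a , (λ j → τ.a≥1 j , ℕ.≤-trans (τ.a≤GN² j) (ℕ.*-monoˡ-≤ (N ℕ.* N) (≤-sum G j))) , record
    { N = N ; I = ℕΣ.sum I ; e = suc o ; A = A ; d = d ; near = τ.near
    ; N≢0 = ℕ.≢-nonZero (ℕ.≢-nonZero⁻¹ N)
    ; sum-A = ℤ.+-injective sum-A
    ; gap = trans (sym 1+d+o≡) (sym (ℕ.+-suc (ℕΣ.sum d) o))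
    ; Σd≤N = ℕ.≤-trans (ℕ.n≤1+n (ℕΣ.sum d)) 1+Σd≤N
    ; 2c≤m = ℕ.≤-trans 2c≤N (ℕ.≤-trans (ℕ.m≤m*n N (N ^ κ) {{ℕ.m^n≢0 N κ}}) (rising≥N^ k N)) }
    where
    1+Σd+2c≤N = ℕ.≤-trans (ℕ.m≤n+m (suc (ℕΣ.sum d) ℕ.+ 2 ℕ.* c) (ℕΣ.sum N₀)) N≥
    1+Σd≤N = ℕ.≤-trans (ℕ.m≤m+n (suc (ℕΣ.sum d)) (2 ℕ.* c)) 1+Σd+2c≤N
    2c≤N = ℕ.≤-trans (ℕ.m≤n+m (2 ℕ.* c) (suc (ℕΣ.sum d))) 1+Σd+2c≤N
    remainder = ℕ.m≤n⇒∃[o]m+o≡n (ℕ.≤-trans 1+Σd≤N (ℕ.m≤n*m N c))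
    o = proj₁ remainder
    1+d+o≡ = proj₂ remainder
    terms : ∀ j → Term k (x j) (g j) (d j) (G j) N
    terms j = proj₂ (proj₂ (proj₂ (term k (x j) (g j)))) N (ℕ.≤-trans (≤-sum N₀ j) (ℕ.≤-trans (ℕ.m≤m+n (ℕΣ.sum N₀) _) N≥))
    module τ j = Term (terms j)
    a A I : Fin k → ℕ
    a = τ.a
    A = τ.A
    I = τ.I
    m = + rising k N
    sum-A : + ℕΣ.sum A ≡ + (ℕΣ.sum I ℕ.* rising k N ℕ.+ c)
    sum-A = begin
      + ℕΣ.sum A                                                                        ≡⟨ pos-sum A ⟩
      ℤΣ.sum (λ j → + A j)                                                              ≡⟨ ℤΣ.sum-cong-≗ τ.A-split ⟩
      ℤΣ.sum (λ j → + I j ℤ.* m ℤ.+ + x j ℤ.* numerator (coefs (g j)) k N)                      ≡⟨ ℤΣ.∑-distrib-+ (λ j → + I j ℤ.* m) (λ j → + x j ℤ.* numerator (coefs (g j)) k N) ⟩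
      ℤΣ.sum (λ j → + I j ℤ.* m) ℤ.+ ℤΣ.sum (λ j → + x j ℤ.* numerator (coefs (g j)) k N)       ≡⟨ cong₂ ℤ._+_
        (trans (sym (ℤΣ.*-distribʳ-sum m (λ j → + I j))) (trans (cong (ℤ._* m) (sym (pos-sum I))) (sym (ℤ.pos-* (ℕΣ.sum I) (rising k N)))))
        (trans (numerator-linear x (λ j → coefs (g j)) k N) (Qu N)) ⟩
      + (ℕΣ.sum I ℕ.* rising k N ℕ.+ c)                                                      ∎
      where open ≡-Reasoning

-- √2 + 1 + ⋯ + 1, with √2 ≈ 7/5
small-certificate : ∀ κ → Certificate (2 ◂ λ (_ : Fin κ) → 1) 5 2
small-certificate κ = record
  -- As `2 · 5² - 7² = 1`, `Near` holds with `A = 7` and `d = 1` for `N` up to 7; then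
  -- `cN = 14 = 1 + 13`.
  { N = 7 ; I = suc κ ; e = 13 ; A = 7 ◂ λ _ → 5 ; d = 1 ◂ λ _ → 0
  ; near = λ { zero → record { upper = ℕ.≤ᵇ⇒≤ 350 350 _ ; lower = ℕ.≤ᵇ⇒≤ 343 357 _ }
             ; (suc j) → record { upper = ℕ.≤-refl ; lower = ℕ.≤-refl } }
  ; sum-A = trans (cong (7 ℕ.+_) (sum-const κ 5)) (aux κ)
  ; gap = cong (λ z → suc z ℕ.+ 13) (sym Σ0)
  ; Σd≤N = subst (λ z → suc z ≤ 7) (sym Σ0) (s≤s z≤n)
  ; 2c≤m = ℕ.n≤1+n 4 }
  where
  Σ0 : ℕΣ.sum {κ} (λ _ → 0) ≡ 0
  Σ0 = trans (sum-const κ 0) (ℕ.*-zeroʳ κ)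
  aux : ∀ κ → 7 ℕ.+ κ ℕ.* 5 ≡ (1 ℕ.+ κ) ℕ.* 5 ℕ.+ 2
  aux = ℕSolver.solve-∀

-- Choice of the constant, and of N for a given n

n<[1+⌊√n/G⌋]²G : ∀ n G .{{_ : NonZero G}} → let N = ⌊√ n ℕ./ G ⌋ in n < suc N ℕ.* suc N ℕ.* G
n<[1+⌊√n/G⌋]²G n G = begin-strict
  n                                     ≡⟨ ℕ.m≡m%n+[m/n]*n n G ⟩
  n ℕ.% G ℕ.+ n ℕ./ G ℕ.* G             <⟨ ℕ.+-monoˡ-< (n ℕ./ G ℕ.* G) (ℕ.m%n<n n G) ⟩
  suc (n ℕ./ G) ℕ.* G                   ≤⟨ ℕ.*-monoˡ-≤ G (n<[1+⌊√n⌋]² (n ℕ./ G)) ⟩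
  suc N ℕ.* suc N ℕ.* G                 ∎
  where
  open ℕ.≤-Reasoning
  N = ⌊√ n ℕ./ G ⌋

theorem1p1 : ∀ (k : ℕ) .{{_ : NonZero k}} →
    Σ[ C ∈ ℝ ] 0ℝ <ℝ C ×
    (∀ (n : ℕ) .{{_ : NonZero n}} → n ≢ 1 →
    Σ[ a ∈ (Fin k → ℕ) ]
    (∀ (j : Fin k) → 1 ≤ a j × a j ≤ n) ×
    0ℝ <ℝ ‖ ∑ (λ j → √ (+ a j / 1)) ‖ ×
    ‖ ∑ (λ j → √ (+ a j / 1)) ‖ ≤ℝ C *ℝ n ^-[ k /2])
theorem1p1 zero {{()}}
theorem1p1 (suc κ) with construction κ
... | c , G₀ , N₀ , build = ofℕ C , 0<ofℕ C 2<C , choose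
  where
  k = suc κ
  G = suc G₀
  H = suc N₀ ℕ.* suc N₀ ℕ.* G
  -- `C₁` is for large `n`, where `n ≤ 4GN²` and `N^k ≤ rising k N`; it takes `(4G)^k` in place of
  -- its square root to stay in ℕ. `C₂` is for `n ≤ H`, and its summand 3 gives `2 < C`.
  C₁ = suc c ℕ.* (4 ℕ.* G) ^ k
  C₂ = 3 ℕ.+ 3 ℕ.* H ^ k
  C = C₁ ℕ.+ C₂
  2<C : 2 < C
  2<C = ℕ.≤-trans (ℕ.m≤m+n 3 (3 ℕ.* H ^ k)) (ℕ.m≤n+m C₂ C₁)
  choose : ∀ n .{{_ : NonZero n}} → n ≢ 1 → Σ[ a ∈ (Fin k → ℕ) ] (∀ j → 1 ≤ a j × a j ≤ n) ×
    0ℝ <ℝ ‖ ∑√ a ‖ × ‖ ∑√ a ‖ ≤ℝ ofℕ C *ℝ n ^-[ k /2]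
  -- Asking for more than `N₀` also makes `N` nonzero.
  choose n n≢1 with suc N₀ ℕ.≤? ⌊√ n ℕ./ G ⌋
  ... | yes N₀<N = a , (λ j → proj₁ (bounds j) , ℕ.≤-trans (proj₂ (bounds j)) G₀N²≤n) ,
        0<‖∑√‖ cert , ‖∑√‖≤C*n^-[k/2] cert n k small
    where
    N = ⌊√ n ℕ./ G ⌋
    instance
      N≢0 : NonZero N
      N≢0 = ℕ.>-nonZero (ℕ.≤-trans (s≤s z≤n) N₀<N)
    built = build N (ℕ.≤-trans (ℕ.n≤1+n N₀) N₀<N)
    a = proj₁ built
    bounds = proj₁ (proj₂ built)
    cert = proj₂ (proj₂ built)
    m = rising k N
    N^k≤m : N ^ k ≤ m
    N^k≤m = rising≥N^ k N
    instance
      m≢0 : NonZero m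
      m≢0 = ℕ.>-nonZero (ℕ.≤-trans (ℕ.m^n>0 N k) N^k≤m)
    open ℕ.≤-Reasoning
    G₀N²≤n : G₀ ℕ.* (N ℕ.* N) ≤ n
    G₀N²≤n = begin
      G₀ ℕ.* (N ℕ.* N)       ≤⟨ ℕ.*-monoˡ-≤ (N ℕ.* N) (ℕ.n≤1+n G₀) ⟩
      G ℕ.* (N ℕ.* N)        ≡⟨ ℕ.*-comm G (N ℕ.* N) ⟩
      N ℕ.* N ℕ.* G          ≤⟨ ℕ.*-monoˡ-≤ G (⌊√n⌋²≤n (n ℕ./ G)) ⟩
      n ℕ./ G ℕ.* G          ≤⟨ ℕ.m/n*n≤m n G ⟩
      n                      ∎
    1+N≤2N : suc N ≤ 2 ℕ.* N
    1+N≤2N = subst (suc N ≤_) (cong (N ℕ.+_) (sym (ℕ.+-identityʳ N))) (ℕ.+-monoˡ-≤ N (ℕ.>-nonZero⁻¹ N))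
    n≤ : n ≤ 4 ℕ.* G ℕ.* (N ℕ.* N)
    n≤ = begin
      n                                      ≤⟨ ℕ.<⇒≤ (n<[1+⌊√n/G⌋]²G n G) ⟩
      suc N ℕ.* suc N ℕ.* G                  ≤⟨ ℕ.*-monoˡ-≤ G (ℕ.*-mono-≤ 1+N≤2N 1+N≤2N) ⟩
      2 ℕ.* N ℕ.* (2 ℕ.* N) ℕ.* G            ≡⟨ aux N G ⟩
      4 ℕ.* G ℕ.* (N ℕ.* N)                  ∎
      where
      aux : ∀ N G → 2 ℕ.* N ℕ.* (2 ℕ.* N) ℕ.* G ≡ 4 ℕ.* G ℕ.* (N ℕ.* N)
      aux = ℕSolver.solve-∀
    F = (4 ℕ.* G) ^ k
    small : suc c ℕ.* suc c ℕ.* n ^ k ≤ C ℕ.* C ℕ.* (m ℕ.* m)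
    small = begin
      suc c ℕ.* suc c ℕ.* n ^ k                                    ≤⟨ ℕ.*-monoʳ-≤ (suc c ℕ.* suc c) (ℕ.^-monoˡ-≤ k n≤) ⟩
      suc c ℕ.* suc c ℕ.* (4 ℕ.* G ℕ.* (N ℕ.* N)) ^ k              ≡⟨ cong (suc c ℕ.* suc c ℕ.*_) (trans (^-distribʳ-* (4 ℕ.* G) (N ℕ.* N) k) (cong (F ℕ.*_) (^-distribʳ-* N N k))) ⟩
      suc c ℕ.* suc c ℕ.* (F ℕ.* (N ^ k ℕ.* N ^ k))                ≤⟨ ℕ.*-monoʳ-≤ (suc c ℕ.* suc c) (ℕ.*-mono-≤ (ℕ.m≤m*n F F {{ℕ.m^n≢0 (4 ℕ.* G) k}}) (ℕ.*-mono-≤ N^k≤m N^k≤m)) ⟩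
      suc c ℕ.* suc c ℕ.* (F ℕ.* F ℕ.* (m ℕ.* m))                  ≡⟨ aux (suc c) F (m ℕ.* m) ⟩
      C₁ ℕ.* C₁ ℕ.* (m ℕ.* m)                                      ≤⟨ ℕ.*-monoˡ-≤ (m ℕ.* m) (ℕ.*-mono-≤ (ℕ.m≤m+n C₁ C₂) (ℕ.m≤m+n C₁ C₂)) ⟩
      C ℕ.* C ℕ.* (m ℕ.* m)                                        ∎
      where
      aux : ∀ c F m → c ℕ.* c ℕ.* (F ℕ.* F ℕ.* m) ≡ c ℕ.* F ℕ.* (c ℕ.* F) ℕ.* m
      aux = ℕSolver.solve-∀
  ... | no N₀≮N = (2 ◂ λ _ → 1) , (λ { zero → s≤s z≤n , n≥2 ; (suc j) → s≤s z≤n , ℕ.>-nonZero⁻¹ n }) ,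
        0<‖∑√‖ (small-certificate κ) , ‖∑√‖≤C*n^-[k/2] (small-certificate κ) n k small
    where
    open ℕ.≤-Reasoning
    -- For `n = 1` every `a j` would be 1 and the sum an integer, at distance 0; the radicand 2 fits
    -- only from `n = 2` on.
    n≥2 : 2 ≤ n
    n≥2 = ℕ.≤∧≢⇒< (ℕ.>-nonZero⁻¹ n) (λ 1≡n → n≢1 (sym 1≡n))
    n≤H : n ≤ H
    n≤H = ℕ.≤-trans (ℕ.<⇒≤ (n<[1+⌊√n/G⌋]²G n G)) (ℕ.*-monoˡ-≤ G (ℕ.*-mono-≤ (ℕ.≰⇒> N₀≮N) (ℕ.≰⇒> N₀≮N)))
    small : 9 ℕ.* n ^ k ≤ C ℕ.* C ℕ.* 25
    small = begin
      9 ℕ.* n ^ k                ≡⟨ ℕ.*-assoc 3 3 (n ^ k) ⟩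
      3 ℕ.* (3 ℕ.* n ^ k)        ≤⟨ ℕ.*-mono-≤ 2<C (ℕ.≤-trans (ℕ.*-monoʳ-≤ 3 (ℕ.^-monoˡ-≤ k n≤H)) (ℕ.≤-trans (ℕ.m≤n+m (3 ℕ.* H ^ k) 3) (ℕ.m≤n+m C₂ C₁))) ⟩
      C ℕ.* C                    ≤⟨ ℕ.m≤m*n (C ℕ.* C) 25 ⟩
      C ℕ.* C ℕ.* 25             ∎
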